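{- For each of the triples \[ (p,r,m)\in\{(5,3,2),\ (7,5,3),\ (11,10,5),\ (17,3,9),\ (19,5,10),\ (23,10,12),\ (29,20,15)\}, \] we have \[ \sum_{n=0}^\infty \mathcal{EO}_u (4pn+4r+2)q^n\equiv q^m\sum_{n=0}^\infty \mathcal{EO}_u (4n+2)q^{pn}\pmod{4}. \]
   Context: For a positive integer $k$, let $f_k:=(q^k;q^k)_\infty=\prod_{i=1}^\infty(1-q^{ki})$. The integers $\mathcal{EO}_u(n)$, $n\ge 0$, are defined by $\sum_{n=0}^\infty \mathcal{EO}_u(n)q^n=\dfrac{f_4^2}{f_2^2}$. A congruence between power series in $q$ with integer coefficients modulo $4$ means that the coefficients of each power of $q$ are congruent modulo $4$. -}

module Defs where

open import Data.Fin.Base using (Fin; zero; suc; toℕ)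
open import Data.Integer.Base
  using (ℤ; +_; 0ℤ; 1ℤ; _+_; _-_; _*_) renaming (-_ to infix 8 -_)
open import Data.Integer.Divisibility.Signed using () renaming (_∣_ to _∣ℤ_)
import Data.Integer.Properties as ℤ
open import Data.Nat.Base as ℕ using (ℕ; zero; suc; NonZero; _∸_; _≤_; _<_; s≤s; z≤n)
open import Data.Nat.Divisibility using (_∣?_; quotient)
import Data.Nat.Properties as ℕ
open import Data.Vec.Base using (Vec; []; _∷_; head; lookup)
open import Relation.Binary.PropositionalEquality
  using (_≡_; refl; sym; trans; cong; cong₂; _≗_; module ≡-Reasoning)
open import Relation.Nullary.Decidable.Core using (yes; no)
open import Relation.Nullary.Negation using (contradiction)

open import Algebra.Properties.Monoid.Sum ℤ.+-0-monoid
  using (sum-syntax; sum⁺-syntax; sum-cong-≗; sum-replicate-zero)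

-- The series ∑ aₙ qⁿ is represented by its coefficient function n ↦ aₙ.
PowerSeries : Set
PowerSeries = ℕ → ℤ

infix  9 q^_ _⁻¹
infixl 7 _⊛_ _⊘_
infixl 6 _⊖_
infix  4 _≡_[mod_]

q^_ : ℕ → PowerSeries
(q^ m) n with m ℕ.≟ n
... | yes _ = 1ℤ
... | no  _ = 0ℤ

_⊖_ : PowerSeries → PowerSeries → PowerSeries
(a ⊖ b) n = a n - b n

_⊛_ : PowerSeries → PowerSeries → PowerSeries
(a ⊛ b) n = ∑[ i ≤ n ] (a (toℕ i) * b (n ∸ toℕ i))

-- recip a n lists the coefficients hₙ , … , h₁ , h₀ (in this order) of
-- h = 1 / a, from h₀ = 1 and hₙ₊₁ = - ∑_{i=0}^{n} aᵢ₊₁ hₙ₋ᵢ.  This is the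
-- reciprocal of a only if a has constant term 1; see ⊛-inverseʳ.
recip : PowerSeries → (n : ℕ) → Vec ℤ (suc n)
recip a zero    = 1ℤ ∷ []
recip a (suc n) =
  - (∑[ i ≤ n ] (a (suc (toℕ i)) * lookup (recip a n) i)) ∷ recip a n

_⁻¹ : PowerSeries → PowerSeries
(a ⁻¹) n = head (recip a n)

_⊘_ : PowerSeries → PowerSeries → PowerSeries
a ⊘ b = a ⊛ b ⁻¹

-- dilate p a is ∑ aₙ q^(p n), for p positive.
dilate : ℕ → PowerSeries → PowerSeries
dilate p a k with p ∣? k
... | yes p∣k = a (quotient p∣k)
... | no  _   = 0ℤ

_≡_[mod_] : PowerSeries → PowerSeries → ℤ → Set
a ≡ b [mod m ] = ∀ n → m ∣ℤ (a n - b n)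

-- ∏_{i=1}^{N} (1 - q^(k i))
partialProduct : ℕ → ℕ → PowerSeries
partialProduct k zero    = q^ 0
partialProduct k (suc N) = (q^ 0 ⊖ q^ (k ℕ.* suc N)) ⊛ partialProduct k N

-- f k = ∏_{i≥1} (1 - q^(k i)).  The factors with i > n do not affect the
-- coefficient of qⁿ, which is therefore that of the n-th partial product;
-- see f-limit.
f : (k : ℕ) → .{{NonZero k}} → PowerSeries
f k n = partialProduct k n n

EOᵤ : PowerSeries
EOᵤ = (f 4 ⊛ f 4) ⊘ (f 2 ⊛ f 2)

private
  lookup-recip : ∀ a n (i : Fin (suc n)) →
                 lookup (recip a n) i ≡ (a ⁻¹) (n ∸ toℕ i)
  lookup-recip a zero    zero    = refl
  lookup-recip a (suc n) zero    = refl
  lookup-recip a (suc n) (suc i) = lookup-recip a n i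

⊛-inverseʳ : ∀ a → a 0 ≡ 1ℤ → a ⊛ a ⁻¹ ≗ q^ 0
⊛-inverseʳ a a₀≡1 zero rewrite a₀≡1 = refl
⊛-inverseʳ a a₀≡1 (suc n) = begin
  a 0 * (- s) + (∑[ i ≤ n ] (a (suc (toℕ i)) * (a ⁻¹) (n ∸ toℕ i)))
    ≡⟨ cong₂ _+_ (trans (cong (_* (- s)) a₀≡1) (ℤ.*-identityˡ (- s)))
         (sum-cong-≗ λ i → cong (a (suc (toℕ i)) *_) (sym (lookup-recip a n i))) ⟩
  - s + s
    ≡⟨ ℤ.+-inverseˡ s ⟩
  0ℤ ∎
  where
  open ≡-Reasoning
  s = ∑[ i ≤ n ] (a (suc (toℕ i)) * lookup (recip a n) i)

private
  q^-≢ : ∀ {m n} → n < m → (q^ m) n ≡ 0ℤ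
  q^-≢ {m} {n} n<m with m ℕ.≟ n
  ... | yes refl = contradiction n<m (ℕ.<-irrefl refl)
  ... | no  _    = refl

  1-q^-⊛ : ∀ {j n} a → n < j → ((q^ 0 ⊖ q^ j) ⊛ a) n ≡ a n
  1-q^-⊛ {j} {n} a n<j = begin
    (1ℤ - (q^ j) 0) * a n + (∑[ i < n ] (c (suc (toℕ i)) * a (n ∸ suc (toℕ i))))
      ≡⟨ cong₂ _+_ (cong (λ x → (1ℤ - x) * a n) (q^-≢ (ℕ.≤-<-trans z≤n n<j)))
           (sum-cong-≗ λ i → cong (_* a (n ∸ suc (toℕ i))) (c≡0 i)) ⟩
    1ℤ * a n + (∑[ i < n ] 0ℤ)
      ≡⟨ cong₂ _+_ (ℤ.*-identityˡ (a n)) (sum-replicate-zero n) ⟩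
    a n + 0ℤ
      ≡⟨ ℤ.+-identityʳ (a n) ⟩
    a n ∎
    where
    open ≡-Reasoning
    open import Data.Fin.Properties using (toℕ<n)
    c = q^ 0 ⊖ q^ j
    c≡0 : (i : Fin n) → c (suc (toℕ i)) ≡ 0ℤ
    c≡0 i = cong (λ x → 0ℤ - x) (q^-≢ (ℕ.≤-<-trans (toℕ<n i) n<j))

f-limit : ∀ k .{{_ : NonZero k}} {n N} → n ≤ N → partialProduct k N n ≡ f k n
f-limit k {n} n≤N = go (ℕ.≤⇒≤′ n≤N)
  where
  go : ∀ {N} → n ℕ.≤′ N → partialProduct k N n ≡ f k n
  go (ℕ.≤′-reflexive refl) = refl
  go (ℕ.≤′-step {N} n≤N) = trans
    (1-q^-⊛ (partialProduct k N)
      (ℕ.≤-trans (s≤s (ℕ.≤′⇒≤ n≤N)) (ℕ.m≤n*m (suc N) k)))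
    (go n≤N)

f₂²-constantTerm : (f 2 ⊛ f 2) 0 ≡ 1ℤ
f₂²-constantTerm = refl

{-# OPTIONS --safe #-}
module Submission where

-- Modulo 4, f₂² ≡ f₄ (1 + 2 ∑_{y≥1} q^(2 y²)): in ∏ (1 - u)² / (1 - u²) with u = q^(2 i), each factor is
-- ≡ 1 + 2 u / (1 - u), and in the resulting Lambert series ∑ q^(2 i j) the terms with i ≠ j cancel in
-- pairs.  The square of 1 + 2 ∑ q^(2 y²) being ≡ 1, we get f₄² / f₂² ≡ f₄ (1 + 2 ∑ q^(2 y²)).  With the
-- pentagonal number theorem modulo 2, EOᵤ(4 n + 2) is congruent to twice the number of
-- representations of 24 n + 13 as x² + 12 y² with x ≡ 1 (mod 6) and y > 0.
--
-- The congruences then say that the numbers of representations of p M and of M / p have the same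
-- parity.  For p ≡ 5 (mod 6), p ∣ x² + 12 y² forces p ∣ x and p ∣ y, and the two numbers agree.  For
-- p = 7 and p = 19, which split in ℚ(√-3), their sum counts the representations of p M, with y of any
-- sign, that are divisible by a fixed prime α over p; dividing by α, conjugating and multiplying by α
-- is an involution on these without fixed points.

-- The constants come from two divisions by `p`. As `24 r + 13 = p e`, index `p n + r` belongs to
-- the form value `24 (p n + r) + 13 = p M` with `M = 24 n + e`. As `24 m + e = 13 p`, `p` divides
-- `M` exactly when `n ≡ m (mod p)`, and `n = m + k p` gives `M / p = 24 k + 13`, the value
-- belonging to index `k`: hence the shift by `q^ m` and the dilation by `p`.
--
-- In the split case the obstacle is that only y > 0 is counted, while the involution acts on points
-- with y of either sign. Conjugation bridges this. If p does not divide a point, exactly one of the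
-- point and its conjugate is divisible by α; if p divides it, both are, and the surplus copy is a
-- representation of `M / p`. Points with y = 0 do not occur because `24 n + 13` is not 1 modulo 24.
-- The fixed line of the involution is avoided because it consists of points with even x, while x ≡
-- 1 (mod 6).

open import Defs

-- Truncated power series as a commutative ring.

module PowerSeriesRing where

  open import Algebra.Bundles using (CommutativeRing)
  import Algebra.Solver.Ring
  open import Algebra.Solver.Ring.AlmostCommutativeRing
    using (fromCommutativeRing; _-Raw-AlmostCommutative⟶_)
  open import Data.Integer.Base as ℤ using (ℤ; 0ℤ; 1ℤ; _+_; _-_; _*_; -_)
  open import Data.Integer.Divisibility.Signed as ℤ∣ using (divides) renaming (_∣_ to _∣ℤ_)
  import Data.Integer.Properties as ℤ
  open import Data.Integer.Tactic.RingSolver using (solve-∀)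
  open import Data.Maybe.Base using (Maybe; just; nothing)
  open import Data.Nat.Base as ℕ using (ℕ; zero; suc; _≤_; _<_; z≤n; s≤s)
  import Data.Nat.Properties as ℕ
  open import Data.Product.Base using (_,_)
  open import Function.Base using (_∘_)
  open import Level using (0ℓ)
  open import Relation.Binary.PropositionalEquality
  open import Relation.Nullary using (yes; no; contradiction)

  infixl 6 _⊕_
  infix  8 ⊝_

  _⊕_ : PowerSeries → PowerSeries → PowerSeries
  (a ⊕ b) n = a n + b n

  ⊝_ : PowerSeries → PowerSeries
  (⊝ a) n = - a n

  const : ℤ → PowerSeries
  const c zero    = c
  const c (suc n) = 0ℤ

  0# : PowerSeries
  0# = const 0ℤ

  private
    interchange : ∀ w x y z → (w + x) + (y + z) ≡ (w + y) + (x + z)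
    interchange = solve-∀

  0#≗0 : ∀ n → 0# n ≡ 0ℤ
  0#≗0 zero    = refl
  0#≗0 (suc n) = refl

  ⊛-congʳ : ∀ {a a′} b → a ≗ a′ → a ⊛ b ≗ a′ ⊛ b
  ⊛-congʳ b p zero    = cong (λ x → x * b 0 + 0ℤ) (p 0)
  ⊛-congʳ b p (suc n) = cong₂ _+_ (cong (_* b (suc n)) (p 0)) (⊛-congʳ b (p ∘ suc) n)

  ⊛-zeroˡ : ∀ {a} b → a ≗ 0# → a ⊛ b ≗ 0#
  ⊛-zeroˡ {a} b p zero    rewrite p 0 = refl
  ⊛-zeroˡ {a} b p (suc n) rewrite p 0 =
    trans (ℤ.+-identityˡ _) (trans (⊛-zeroˡ b (λ i → trans (p (suc i)) (sym (0#≗0 i))) n) (0#≗0 n))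

  ⊛-distribʳ : ∀ c a b → (a ⊕ b) ⊛ c ≗ a ⊛ c ⊕ b ⊛ c
  ⊛-distribʳ c a b zero    = distrib (a 0) (b 0) (c 0)
    where
    distrib : ∀ x y z → (x + y) * z + 0ℤ ≡ (x * z + 0ℤ) + (y * z + 0ℤ)
    distrib = solve-∀
  ⊛-distribʳ c a b (suc n) = trans
    (cong₂ _+_ (ℤ.*-distribʳ-+ (c (suc n)) (a 0) (b 0)) (⊛-distribʳ c (a ∘ suc) (b ∘ suc) n))
    (interchange (a 0 * c (suc n)) (b 0 * c (suc n)) _ _)

  -- `⊛` unfolds by peeling off the constant term of the left factor. Peeling that of the right
  -- factor is the mirror recursion, which turns commutativity into an induction.
  ⊛-sucʳ : ∀ a b n → (a ⊛ b) (suc n) ≡ (a ⊛ (b ∘ suc)) n + a (suc n) * b 0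
  ⊛-sucʳ a b zero    = move0 (a 0 * b 1) (a 1 * b 0)
    where
    move0 : ∀ x y → x + (y + 0ℤ) ≡ (x + 0ℤ) + y
    move0 = solve-∀
  ⊛-sucʳ a b (suc n) = trans
    (cong (a 0 * b (suc (suc n)) +_) (⊛-sucʳ (a ∘ suc) b n))
    (sym (ℤ.+-assoc (a 0 * b (suc (suc n))) _ _))

  ⊛-comm : ∀ a b → a ⊛ b ≗ b ⊛ a
  ⊛-comm a b zero    = cong (_+ 0ℤ) (ℤ.*-comm (a 0) (b 0))
  ⊛-comm a b (suc n) = begin
    a 0 * b (suc n) + ((a ∘ suc) ⊛ b) n  ≡⟨ ℤ.+-comm (a 0 * b (suc n)) _ ⟩
    ((a ∘ suc) ⊛ b) n + a 0 * b (suc n)  ≡⟨ cong₂ _+_ (⊛-comm (a ∘ suc) b n) (ℤ.*-comm (a 0) _) ⟩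
    (b ⊛ (a ∘ suc)) n + b (suc n) * a 0  ≡⟨ ⊛-sucʳ b a n ⟨
    (b ⊛ a) (suc n)                      ∎
    where open ≡-Reasoning

  scale : ℤ → PowerSeries → PowerSeries
  scale c a n = c * a n

  ⊛-scaleˡ : ∀ c a b → scale c a ⊛ b ≗ scale c (a ⊛ b)
  ⊛-scaleˡ c a b zero    = assoc₀ c (a 0) (b 0)
    where
    assoc₀ : ∀ x y z → (x * y) * z + 0ℤ ≡ x * (y * z + 0ℤ)
    assoc₀ = solve-∀
  ⊛-scaleˡ c a b (suc n) = trans
    (cong₂ _+_ (ℤ.*-assoc c (a 0) (b (suc n))) (⊛-scaleˡ c (a ∘ suc) b n))
    (sym (ℤ.*-distribˡ-+ c _ _))

  ⊛-assoc : ∀ a b c → (a ⊛ b) ⊛ c ≗ a ⊛ (b ⊛ c)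
  ⊛-assoc a b c zero    = assoc₀ (a 0) (b 0) (c 0)
    where
    assoc₀ : ∀ x y z → (x * y + 0ℤ) * z + 0ℤ ≡ x * (y * z + 0ℤ) + 0ℤ
    assoc₀ = solve-∀
  ⊛-assoc a b c (suc n) = begin
    (a 0 * b 0 + 0ℤ) * c (suc n) + ((scale (a 0) (b ∘ suc) ⊕ (a ∘ suc) ⊛ b) ⊛ c) n
      ≡⟨ cong (s +_) (⊛-distribʳ c (scale (a 0) (b ∘ suc)) ((a ∘ suc) ⊛ b) n) ⟩
    (a 0 * b 0 + 0ℤ) * c (suc n) + ((scale (a 0) (b ∘ suc) ⊛ c) n + (((a ∘ suc) ⊛ b) ⊛ c) n)
      ≡⟨ cong (s +_) (cong₂ _+_ (⊛-scaleˡ (a 0) (b ∘ suc) c n) (⊛-assoc (a ∘ suc) b c n)) ⟩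
    (a 0 * b 0 + 0ℤ) * c (suc n) + (a 0 * ((b ∘ suc) ⊛ c) n + ((a ∘ suc) ⊛ (b ⊛ c)) n)
      ≡⟨ regroup (a 0) (b 0) (c (suc n)) _ _ ⟩
    a 0 * (b 0 * c (suc n) + ((b ∘ suc) ⊛ c) n) + ((a ∘ suc) ⊛ (b ⊛ c)) n ∎
    where
    open ≡-Reasoning
    s = (a 0 * b 0 + 0ℤ) * c (suc n)
    regroup : ∀ x y z s t → (x * y + 0ℤ) * z + (x * s + t) ≡ x * (y * z + s) + t
    regroup = solve-∀

  const-⊛ : ∀ c a → const c ⊛ a ≗ scale c a
  const-⊛ c a zero    = ℤ.+-identityʳ _
  const-⊛ c a (suc n) = trans
    (cong (c * a (suc n) +_) (trans (⊛-zeroˡ a (λ i → sym (0#≗0 i)) n) (0#≗0 n)))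
    (ℤ.+-identityʳ _)

  q^0≗1 : q^ 0 ≗ const 1ℤ
  q^0≗1 zero    = refl
  q^0≗1 (suc n) = refl

  ⊛-identityˡ : ∀ a → q^ 0 ⊛ a ≗ a
  ⊛-identityˡ a n = trans (⊛-congʳ a q^0≗1 n) (trans (const-⊛ 1ℤ a n) (ℤ.*-identityˡ (a n)))

  -- The constant series c, with embed 1ℤ definitionally equal to q^ 0, so that the ring solver
  -- recognises q^ 0 as a coefficient.
  embed : ℤ → PowerSeries
  embed (ℤ.+ 1) = q^ 0
  embed c       = const c

  embed≗const : ∀ c → embed c ≗ const c
  embed≗const (ℤ.+ zero)        n = refl
  embed≗const (ℤ.+ suc zero)    n = q^0≗1 n
  embed≗const (ℤ.+ suc (suc _)) n = refl
  embed≗const ℤ.-[1+ _ ]        n = refl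

  embed-⊛ : ∀ c a → embed c ⊛ a ≗ scale c a
  embed-⊛ c a n = trans (⊛-congʳ a (embed≗const c) n) (const-⊛ c a n)

  q^-diag : ∀ n → (q^ n) n ≡ 1ℤ
  q^-diag n with n ℕ.≟ n
  ... | yes _  = refl
  ... | no n≢n = contradiction refl n≢n

  q^-off : ∀ {m n} → m ≢ n → (q^ m) n ≡ 0ℤ
  q^-off {m} {n} m≢n with m ℕ.≟ n
  ... | yes m≡n = contradiction m≡n m≢n
  ... | no _    = refl

  q^-suc : ∀ m n → (q^ suc m) (suc n) ≡ (q^ m) n
  q^-suc m n with m ℕ.≟ n
  ... | yes refl = q^-diag (suc n)
  ... | no  m≢n  = q^-off (m≢n ∘ ℕ.suc-injective)

  q^-suc-⊛ : ∀ m a n → (q^ suc m ⊛ a) (suc n) ≡ (q^ m ⊛ a) n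
  q^-suc-⊛ m a n = trans (ℤ.+-identityˡ _) (⊛-congʳ a (q^-suc m) n)

  q^-⊛-+ : ∀ m a k → (q^ m ⊛ a) (m ℕ.+ k) ≡ a k
  q^-⊛-+ zero    a k = ⊛-identityˡ a k
  q^-⊛-+ (suc m) a k = trans (q^-suc-⊛ m a (m ℕ.+ k)) (q^-⊛-+ m a k)

  q^-⊛-< : ∀ {m n} a → n < m → (q^ m ⊛ a) n ≡ 0ℤ
  q^-⊛-< {suc m} {zero}  a _         = refl
  q^-⊛-< {suc m} {suc n} a (s≤s n<m) = trans (q^-suc-⊛ m a n) (q^-⊛-< a n<m)

  q^-⊛-q^ : ∀ m n → q^ m ⊛ q^ n ≗ q^ (m ℕ.+ n)
  q^-⊛-q^ zero    n k       = ⊛-identityˡ (q^ n) k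
  q^-⊛-q^ (suc m) n zero    = refl
  q^-⊛-q^ (suc m) n (suc k) =
    trans (q^-suc-⊛ m (q^ n) k) (trans (q^-⊛-q^ m n k) (sym (q^-suc (m ℕ.+ n) k)))

  module Truncated (m : ℤ) (B : ℕ) where

    infix 4 _≈_
    -- The bound `B` allows infinite products and sums to be replaced by finite ones. Being a
    -- record, the relation lets unification recover `a` and `b`, which the divisibility inside it
    -- would not.
    record _≈_ (a b : PowerSeries) : Set where
      constructor mk
      field coeff : ∀ n → n < B → m ∣ℤ (a n - b n)
    open _≈_ public

    ≗<⇒≈ : ∀ {a b} → (∀ n → n < B → a n ≡ b n) → a ≈ b
    ≗<⇒≈ {a} {b} p = mk λ n n<B → subst (m ∣ℤ_)
      (sym (trans (cong (_- b n) (p n n<B)) (ℤ.+-inverseʳ (b n)))) (divides 0ℤ refl)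

    ≗⇒≈ : ∀ {a b} → a ≗ b → a ≈ b
    ≗⇒≈ p = ≗<⇒≈ (λ n _ → p n)

    ≈-sym : ∀ {a b} → a ≈ b → b ≈ a
    ≈-sym {a} {b} p = mk λ n n<B → subst (m ∣ℤ_) (flip (a n) (b n)) (ℤ∣.∣m⇒∣-m (coeff p n n<B))
      where
      flip : ∀ x y → - (x - y) ≡ y - x
      flip = solve-∀

    ≈-trans : ∀ {a b c} → a ≈ b → b ≈ c → a ≈ c
    ≈-trans {a} {b} {c} p q = mk λ n n<B → subst (m ∣ℤ_) (telescope (a n) (b n) (c n))
      (ℤ∣.∣m∣n⇒∣m+n (coeff p n n<B) (coeff q n n<B))
      where
      telescope : ∀ x y z → (x - y) + (y - z) ≡ x - z
      telescope = solve-∀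

    ⊕-cong : ∀ {a a′ b b′} → a ≈ a′ → b ≈ b′ → a ⊕ b ≈ a′ ⊕ b′
    ⊕-cong {a} {a′} {b} {b′} p q = mk λ n n<B → subst (m ∣ℤ_) (regroup (a n) (a′ n) (b n) (b′ n))
      (ℤ∣.∣m∣n⇒∣m+n (coeff p n n<B) (coeff q n n<B))
      where
      regroup : ∀ x x′ y y′ → (x - x′) + (y - y′) ≡ (x + y) - (x′ + y′)
      regroup = solve-∀

    ⊝-cong : ∀ {a b} → a ≈ b → ⊝ a ≈ ⊝ b
    ⊝-cong {a} {b} p = mk λ n n<B → subst (m ∣ℤ_) (regroup (a n) (b n)) (ℤ∣.∣m⇒∣-m (coeff p n n<B))
      where
      regroup : ∀ x y → - (x - y) ≡ (- x) - (- y)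
      regroup = solve-∀

    ⊛-∣ : ∀ {a} b n → (∀ i → i ≤ n → m ∣ℤ a i) → m ∣ℤ (a ⊛ b) n
    ⊛-∣ b zero    p = ℤ∣.∣m∣n⇒∣m+n (ℤ∣.∣m⇒∣m*n (b 0) (p 0 z≤n)) (divides 0ℤ refl)
    ⊛-∣ b (suc n) p = ℤ∣.∣m∣n⇒∣m+n (ℤ∣.∣m⇒∣m*n (b (suc n)) (p 0 z≤n))
      (⊛-∣ b n (λ i i≤n → p (suc i) (s≤s i≤n)))

    ⊛-congʳ≈ : ∀ {a a′} b → a ≈ a′ → a ⊛ b ≈ a′ ⊛ b
    ⊛-congʳ≈ {a} {a′} b p = mk λ n n<B → subst (m ∣ℤ_) (eq n)
      (⊛-∣ b n (λ i i≤n → coeff p i (ℕ.≤-<-trans i≤n n<B)))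
      where
      cancel : ∀ x y → x ≡ (x + y) - y
      cancel = solve-∀
      rejoin : ∀ x y → (x - y) + y ≡ x
      rejoin = solve-∀
      eq : ∀ n → ((a ⊖ a′) ⊛ b) n ≡ (a ⊛ b) n - (a′ ⊛ b) n
      eq n = trans (cancel (((a ⊖ a′) ⊛ b) n) ((a′ ⊛ b) n)) (cong (_- (a′ ⊛ b) n)
        (trans (sym (⊛-distribʳ b (a ⊖ a′) a′ n))
          (⊛-congʳ b (λ i → rejoin (a i) (a′ i)) n)))

    ⊛-cong≈ : ∀ {a a′ b b′} → a ≈ a′ → b ≈ b′ → a ⊛ b ≈ a′ ⊛ b′
    ⊛-cong≈ {a} {a′} {b} {b′} p q = ≈-trans (⊛-congʳ≈ b p) (≈-trans (≗⇒≈ (⊛-comm a′ b))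
      (≈-trans (⊛-congʳ≈ a′ q) (≗⇒≈ (⊛-comm b′ a′))))

    ring : CommutativeRing 0ℓ 0ℓ
    ring = record
      { Carrier = PowerSeries
      ; _≈_ = _≈_
      ; _+_ = _⊕_
      ; _*_ = _⊛_
      ; -_ = ⊝_
      ; 0# = 0#
      ; 1# = q^ 0
      ; isCommutativeRing = record
        { isRing = record
          { +-isAbelianGroup = record
            { isGroup = record
              { isMonoid = record
                { isSemigroup = record
                  { isMagma = record
                    { isEquivalence = record { refl = ≗⇒≈ (λ _ → refl) ; sym = ≈-sym ; trans = ≈-trans }
                    ; ∙-cong = ⊕-cong
                    }
                  ; assoc = λ a b c → ≗⇒≈ (λ n → ℤ.+-assoc (a n) (b n) (c n))
                  }
                ; identity = (λ a → ≗⇒≈ (⊕-identityˡ a)) ,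
                             (λ a → ≗⇒≈ (λ n → trans (ℤ.+-comm (a n) (0# n)) (⊕-identityˡ a n)))
                }
              ; inverse = (λ a → ≗⇒≈ (λ n → trans (ℤ.+-inverseˡ (a n)) (sym (0#≗0 n)))) ,
                          (λ a → ≗⇒≈ (λ n → trans (ℤ.+-inverseʳ (a n)) (sym (0#≗0 n))))
              ; ⁻¹-cong = ⊝-cong
              }
            ; comm = λ a b → ≗⇒≈ (λ n → ℤ.+-comm (a n) (b n))
            }
          ; *-cong = ⊛-cong≈
          ; *-assoc = λ a b c → ≗⇒≈ (⊛-assoc a b c)
          ; *-identity = (λ a → ≗⇒≈ (⊛-identityˡ a)) ,
                         (λ a → ≗⇒≈ (λ n → trans (⊛-comm a (q^ 0) n) (⊛-identityˡ a n)))
          ; distrib = (λ a b c → ≗⇒≈ (λ n → trans (⊛-comm a (b ⊕ c) n)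
                        (trans (⊛-distribʳ a b c n) (cong₂ _+_ (⊛-comm b a n) (⊛-comm c a n))))) ,
                      (λ c a b → ≗⇒≈ (⊛-distribʳ c a b))
          }
        ; *-comm = λ a b → ≗⇒≈ (⊛-comm a b)
        }
      }
      where
      ⊕-identityˡ : ∀ a → 0# ⊕ a ≗ a
      ⊕-identityˡ a n = trans (cong (_+ a n) (0#≗0 n)) (ℤ.+-identityˡ (a n))

    embed-morphism : CommutativeRing.rawRing ℤ.+-*-commutativeRing
                     -Raw-AlmostCommutative⟶ fromCommutativeRing ring
    embed-morphism = record
      { ⟦_⟧    = embed
      ; +-homo = λ c d → ≗⇒≈ λ n → trans (embed≗const (c + d) n)
          (trans (const-+ c d n) (sym (cong₂ _+_ (embed≗const c n) (embed≗const d n))))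
      ; *-homo = λ c d → ≗⇒≈ λ n → trans (embed≗const (c * d) n) (sym (trans (embed-⊛ c (embed d) n)
          (trans (cong (c *_) (embed≗const d n)) (const-* c d n))))
      ; -‿homo = λ c → ≗⇒≈ λ n → trans (embed≗const (- c) n)
          (trans (const-neg c n) (sym (cong -_ (embed≗const c n))))
      ; 0-homo = ≗⇒≈ (λ _ → refl)
      ; 1-homo = ≗⇒≈ (λ _ → refl)
      }
      where
      const-+ : ∀ c d n → const (c + d) n ≡ const c n + const d n
      const-+ c d zero    = refl
      const-+ c d (suc n) = refl
      const-* : ∀ c d n → c * const d n ≡ const (c * d) n
      const-* c d zero    = refl
      const-* c d (suc n) = ℤ.*-zeroʳ c
      const-neg : ∀ c n → const (- c) n ≡ - const c n
      const-neg c zero    = refl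
      const-neg c (suc n) = refl

    embed-≟ : ∀ c d → Maybe (embed c ≈ embed d)
    embed-≟ c d with c ℤ.≟ d
    ... | yes refl = just (≗⇒≈ (λ _ → refl))
    ... | no  _    = nothing

    module Solver = Algebra.Solver.Ring
      (CommutativeRing.rawRing ℤ.+-*-commutativeRing) (fromCommutativeRing ring) embed-morphism embed-≟

-- Sums of powers of q and their products.

module EtaQuotient where

  open PowerSeriesRing
  open import Algebra.Bundles using (CommutativeRing)
  open import Data.Integer.Base using (ℤ; 0ℤ; 1ℤ; +_; -[1+_])
    renaming (_+_ to infixl 6 _+ℤ_; _-_ to infixl 6 _-ℤ_; _*_ to infixl 7 _*ℤ_; -_ to infix 8 -ℤ_)
  import Data.Integer.Tactic.RingSolver as ℤRing
  open import Data.Integer.Divisibility.Signed as ℤ∣ using (divides) renaming (_∣_ to _∣ℤ_)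
  import Data.Integer.Properties as ℤ
  open import Data.List.Base using (List; []; _∷_; _++_; map; filter; length; cartesianProduct; downFrom)
  open import Data.List.Properties using (filter-accept; filter-reject)
  open import Data.Nat.Base as ℕ using (ℕ; zero; suc; _+_; _*_; _≤_; _<_; s≤s; NonZero)
  open import Data.Nat.Divisibility as ℕ∣ using (_∣_)
  import Data.Nat.Properties as ℕ
  open import Data.Nat.Tactic.RingSolver using (solve-∀)
  open import Data.Product.Base using (_×_; _,_)
  open import Function.Base using (_∘_; case_of_; _⟨_⟩_)
  open import Relation.Binary.PropositionalEquality hiding (setoid)
  import Relation.Binary.Reasoning.Setoid as SetoidReasoning
  open import Relation.Nullary using (Dec; ¬_; yes; no; contradiction)

  module _ {A : Set} where

    qsum : (A → ℕ) → List A → PowerSeries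
    qsum w []       = 0#
    qsum w (x ∷ xs) = q^ w x ⊕ qsum w xs

    qsum-coeff : ∀ w xs n → qsum w xs n ≡ + length (filter (λ x → w x ℕ.≟ n) xs)
    qsum-coeff w []       n = 0#≗0 n
    qsum-coeff w (x ∷ xs) n = trans (cong ((q^ w x) n +ℤ_) (qsum-coeff w xs n)) count-∷
      where
      P? = λ y → w y ℕ.≟ n
      count-∷ : (q^ w x) n +ℤ + length (filter P? xs) ≡ + length (filter P? (x ∷ xs))
      count-∷ = case w x ℕ.≟ n of λ
        { (yes refl) → cong₂ _+ℤ_ (q^-diag (w x)) (refl {x = + length (filter P? xs)})
                         ⟨ trans ⟩ cong (+_ ∘ length) (sym (filter-accept P? refl))
        ; (no w≢n)   → cong₂ _+ℤ_ (q^-off w≢n) refl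
                         ⟨ trans ⟩ trans (ℤ.+-identityˡ _) (cong (+_ ∘ length) (sym (filter-reject P? w≢n)))
        }

    qsum-++ : ∀ w xs ys → qsum w (xs ++ ys) ≗ qsum w xs ⊕ qsum w ys
    qsum-++ w []       ys n = sym (trans (cong (_+ℤ qsum w ys n) (0#≗0 n)) (ℤ.+-identityˡ _))
    qsum-++ w (x ∷ xs) ys n = trans (cong ((q^ w x) n +ℤ_) (qsum-++ w xs ys n))
      (sym (ℤ.+-assoc ((q^ w x) n) _ _))

  module _ {A B : Set} (w : A → ℕ) (v : B → ℕ) where

    private
      w+v : A × B → ℕ
      w+v (x , y) = w x + v y

    q^-⊛-qsum : ∀ x ys → q^ w x ⊛ qsum v ys ≗ qsum w+v (map (x ,_) ys)
    q^-⊛-qsum x []       n = trans (⊛-comm (q^ w x) 0# n) (⊛-zeroˡ (q^ w x) (λ _ → refl) n)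
    q^-⊛-qsum x (y ∷ ys) n = begin
      (q^ w x ⊛ (q^ v y ⊕ qsum v ys)) n
        ≡⟨ ⊛-comm (q^ w x) (qsum v (y ∷ ys)) n ⟩
      ((q^ v y ⊕ qsum v ys) ⊛ q^ w x) n
        ≡⟨ ⊛-distribʳ (q^ w x) (q^ v y) (qsum v ys) n ⟩
      (q^ v y ⊛ q^ w x) n +ℤ (qsum v ys ⊛ q^ w x) n
        ≡⟨ cong₂ _+ℤ_ (trans (⊛-comm (q^ v y) (q^ w x) n) (q^-⊛-q^ (w x) (v y) n))
             (trans (⊛-comm (qsum v ys) (q^ w x) n) (q^-⊛-qsum x ys n)) ⟩
      (q^ (w x + v y)) n +ℤ qsum w+v (map (x ,_) ys) n ∎
      where open ≡-Reasoning

    qsum-⊛ : ∀ xs ys → qsum w xs ⊛ qsum v ys ≗ qsum w+v (cartesianProduct xs ys)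
    qsum-⊛ []       ys n = ⊛-zeroˡ (qsum v ys) (λ _ → refl) n
    qsum-⊛ (x ∷ xs) ys n = trans (⊛-distribʳ (qsum v ys) (q^ w x) (qsum w xs) n)
      (trans (cong₂ _+ℤ_ (q^-⊛-qsum x ys n) (qsum-⊛ xs ys n))
        (sym (qsum-++ w+v (map (x ,_) ys) (cartesianProduct xs ys) n)))

  -- The pentagonal number theorem modulo 2.

  triangular : ℕ → ℕ
  triangular zero    = 0
  triangular (suc n) = triangular n + suc n

  pentagonal : ℤ → ℕ
  pentagonal (+ n)    = n * n + triangular n
  pentagonal -[1+ n ] = suc n * suc n + triangular n

  integers : ℕ → List ℤ
  integers zero    = + 0 ∷ []
  integers (suc N) = + suc N ∷ -[1+ N ] ∷ integers N

  -- ∑_{t=0}^{s} q^(d (t n + t(t+1)/2)) ∏_{i=t+1}^{s} (1 - q^(d i)), in Horner form: up to the signs,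
  -- which are immaterial modulo 2, this is Shanks' finite form of the pentagonal series.
  shanks : ℕ → ℕ → ℕ → PowerSeries
  shanks d n zero    = q^ 0
  shanks d n (suc s) =
    (q^ 0 ⊖ q^ (d * suc s)) ⊛ shanks d n s ⊕ q^ (d * (suc s * n + triangular (suc s)))

  module TruncatedProperties (m : ℤ) (B : ℕ) where

    open Truncated m B public
    open CommutativeRing ring public
      using (setoid) renaming (refl to ≈-refl)

    ⊕-congˡ : ∀ a {b b′} → b ≈ b′ → a ⊕ b ≈ a ⊕ b′
    ⊕-congˡ a {b} {b′} p = ⊕-cong {a} {a} {b} {b′} ≈-refl p

    ⊕-congʳ : ∀ b {a a′} → a ≈ a′ → a ⊕ b ≈ a′ ⊕ b
    ⊕-congʳ b {a} {a′} p = ⊕-cong {a} {a′} {b} {b} p ≈-refl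

    ⊛-congˡ≈ : ∀ a {b b′} → b ≈ b′ → a ⊛ b ≈ a ⊛ b′
    ⊛-congˡ≈ a {b} {b′} p = ⊛-cong≈ {a} {a} {b} {b′} ≈-refl p

    q^-high : ∀ {e} → B ≤ e → q^ e ≈ 0#
    q^-high B≤e = mk λ n n<B → subst (m ∣ℤ_)
      (sym (cong₂ _-ℤ_ (q^-off (λ e≡n → ℕ.<-irrefl (sym e≡n) (ℕ.<-≤-trans n<B B≤e))) (0#≗0 n)))
      (divides 0ℤ refl)

    q^-⊛ : ∀ e e′ {e″} → e + e′ ≡ e″ → q^ e ⊛ q^ e′ ≈ q^ e″
    q^-⊛ e e′ refl = ≗⇒≈ (q^-⊛-q^ e e′)

    embed≈0 : embed m ≈ 0#
    embed≈0 = mk λ n _ → subst (m ∣ℤ_)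
      (sym (trans (cong₂ _-ℤ_ (embed≗const m n) (0#≗0 n)) (ℤ.+-identityʳ (const m n)))) (m∣const n)
      where
      m∣const : ∀ n → m ∣ℤ const m n
      m∣const zero    = ℤ∣.∣-refl
      m∣const (suc n) = divides 0ℤ refl

    -- The solver proves identities over ℤ. The modulus enters only here: a congruence is first
    -- written as an exact identity with an explicit multiple of `m`, which is then discarded.
    drop-multiple : ∀ a b → a ⊕ embed m ⊛ b ≈ a
    drop-multiple a b = begin
      a ⊕ embed m ⊛ b ≈⟨ ⊕-congˡ a (⊛-congʳ≈ b embed≈0) ⟩
      a ⊕ 0# ⊛ b      ≈⟨ solve 2 (λ a b → a :+ con 0ℤ :* b := a) ≈-refl a b ⟩
      a               ∎
      where
      open SetoidReasoning setoid
      open Solver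

    f≈partialProduct : ∀ k .{{_ : NonZero k}} {N} → B ≤ suc N → f k ≈ partialProduct k N
    f≈partialProduct k B≤ = ≈-sym (≗<⇒≈ λ n n<B → f-limit k (ℕ.s≤s⁻¹ (ℕ.≤-trans n<B B≤)))

    q^-cong : ∀ {e e′} → e ≡ e′ → q^ e ≈ q^ e′
    q^-cong refl = ≈-refl

  module Pentagonal (B : ℕ) where

    open TruncatedProperties (+ 2) B
    open SetoidReasoning setoid
    open Solver

    -- Raising `n` by one and supplying the factor with index `suc n` changes the sum by a single
    -- power of q. This is Shanks' telescoping.
    shanks-step : ∀ d n s → (q^ 0 ⊖ q^ (d * suc n)) ⊛ shanks d (suc n) s ≈
                            shanks d n s ⊕ q^ (d * (suc s * suc n + triangular s))
    shanks-step d n zero = begin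
      (q^ 0 ⊖ v) ⊛ q^ 0
        ≈⟨ solve 1 (λ v → (con 1ℤ :- v) :* con 1ℤ := (con 1ℤ :+ v) :+ con (+ 2) :* (:- v)) ≈-refl v ⟩
      (q^ 0 ⊕ v) ⊕ embed (+ 2) ⊛ (⊝ v)
        ≈⟨ drop-multiple (q^ 0 ⊕ v) (⊝ v) ⟩
      q^ 0 ⊕ v
        ≈⟨ ⊕-congˡ (q^ 0) (q^-cong (exponent d n)) ⟩
      q^ 0 ⊕ q^ (d * (1 * suc n + 0)) ∎
      where
      v = q^ (d * suc n)
      exponent : ∀ d n → d * suc n ≡ d * (1 * suc n + 0)
      exponent = solve-∀
    shanks-step d n (suc s) = begin
      (q^ 0 ⊖ v) ⊛ ((q^ 0 ⊖ u) ⊛ shanks d (suc n) s ⊕ q^ (d * (suc s * suc n + triangular (suc s))))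
        ≈⟨ ⊛-congˡ≈ (q^ 0 ⊖ v) (⊕-congˡ ((q^ 0 ⊖ u) ⊛ shanks d (suc n) s) (q^-⊛ (d * (suc s * suc n + triangular s)) (d * suc s) (exponent₁ d n s (triangular s)))) ⟨
      (q^ 0 ⊖ v) ⊛ ((q^ 0 ⊖ u) ⊛ shanks d (suc n) s ⊕ w ⊛ u)
        ≈⟨ solve 4 (λ u v w h → (con 1ℤ :- v) :* ((con 1ℤ :- u) :* h :+ w :* u) :=
             (con 1ℤ :- u) :* ((con 1ℤ :- v) :* h) :+ (con 1ℤ :- v) :* (w :* u)) ≈-refl u v w (shanks d (suc n) s) ⟩
      (q^ 0 ⊖ u) ⊛ ((q^ 0 ⊖ v) ⊛ shanks d (suc n) s) ⊕ (q^ 0 ⊖ v) ⊛ (w ⊛ u)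
        ≈⟨ ⊕-congʳ ((q^ 0 ⊖ v) ⊛ (w ⊛ u)) (⊛-congˡ≈ (q^ 0 ⊖ u) (shanks-step d n s)) ⟩
      (q^ 0 ⊖ u) ⊛ (shanks d n s ⊕ w) ⊕ (q^ 0 ⊖ v) ⊛ (w ⊛ u)
        -- The terms `w u` cancel. What remains is `w`, the new Horner term of `shanks d n (suc s)`,
        -- and `- w u v`, the new correction up to the sign, which is changed modulo 2.
        ≈⟨ solve 4 (λ u v w h → (con 1ℤ :- u) :* (h :+ w) :+ (con 1ℤ :- v) :* (w :* u) :=
             ((con 1ℤ :- u) :* h :+ w :+ w :* (u :* v)) :+ con (+ 2) :* (:- (w :* (u :* v)))) ≈-refl u v w (shanks d n s) ⟩
      ((q^ 0 ⊖ u) ⊛ shanks d n s ⊕ w ⊕ w ⊛ (u ⊛ v)) ⊕ embed (+ 2) ⊛ (⊝ (w ⊛ (u ⊛ v)))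
        ≈⟨ drop-multiple ((q^ 0 ⊖ u) ⊛ shanks d n s ⊕ w ⊕ w ⊛ (u ⊛ v)) (⊝ (w ⊛ (u ⊛ v))) ⟩
      (q^ 0 ⊖ u) ⊛ shanks d n s ⊕ w ⊕ w ⊛ (u ⊛ v)
        ≈⟨ ⊕-cong (⊕-congˡ ((q^ 0 ⊖ u) ⊛ shanks d n s) (q^-cong (exponent₂ d n s (triangular s))))
             (≈-trans (⊛-congˡ≈ w (q^-⊛ (d * suc s) (d * suc n) refl))
               (q^-⊛ (d * (suc s * suc n + triangular s)) (d * suc s + d * suc n) (exponent₃ d n s (triangular s)))) ⟩
      shanks d n (suc s) ⊕ q^ (d * (suc (suc s) * suc n + triangular (suc s))) ∎
      where
      u = q^ (d * suc s)
      v = q^ (d * suc n)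
      w = q^ (d * (suc s * suc n + triangular s))
      exponent₁ : ∀ d n s t → d * (suc s * suc n + t) + d * suc s ≡ d * (suc s * suc n + (t + suc s))
      exponent₁ = solve-∀
      exponent₂ : ∀ d n s t → d * (suc s * suc n + t) ≡ d * (suc s * n + (t + suc s))
      exponent₂ = solve-∀
      exponent₃ : ∀ d n s t → d * (suc s * suc n + t) + (d * suc s + d * suc n) ≡
                              d * (suc (suc s) * suc n + (t + suc s))
      exponent₃ = solve-∀

    -- Each step along the diagonal s = n adds two powers: the last Horner term, whose exponent
    -- belongs to k = n + 1, and the correction of `shanks-step`, whose exponent belongs to k = - (n
    -- + 1).
    shanks-pentagonal : ∀ d n → shanks d n n ≈ qsum (λ k → d * pentagonal k) (integers n)
    shanks-pentagonal d zero = begin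
      q^ 0                ≈⟨ solve 1 (λ x → x := x :+ con 0ℤ) ≈-refl (q^ 0) ⟩
      q^ 0 ⊕ 0#           ≈⟨ ⊕-congʳ 0# (q^-cong (sym (ℕ.*-zeroʳ d))) ⟩
      q^ (d * 0) ⊕ 0#     ∎
    shanks-pentagonal d (suc n) = begin
      (q^ 0 ⊖ q^ (d * suc n)) ⊛ shanks d (suc n) n ⊕ w
        ≈⟨ ⊕-congʳ w (shanks-step d n n) ⟩
      shanks d n n ⊕ w′ ⊕ w
        ≈⟨ solve 3 (λ h w w′ → h :+ w′ :+ w := w :+ (w′ :+ h)) ≈-refl (shanks d n n) w w′ ⟩
      w ⊕ (w′ ⊕ shanks d n n)
        ≈⟨ ⊕-congˡ w (⊕-congˡ w′ (shanks-pentagonal d n)) ⟩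
      w ⊕ (w′ ⊕ qsum (λ k → d * pentagonal k) (integers n)) ∎
      where
      w  = q^ (d * (suc n * suc n + triangular (suc n)))
      w′ = q^ (d * (suc n * suc n + triangular n))

    -- Every term with t ≥ 1 has exponent at least `d * suc N`, which is beyond the truncation, so
    -- only the bare product, the term t = 0, is left.
    shanks≈partialProduct : ∀ d N → B ≤ d * suc N → ∀ s → shanks d N s ≈ partialProduct d s
    shanks≈partialProduct d N B≤ zero    = ≈-refl
    shanks≈partialProduct d N B≤ (suc s) = begin
      (q^ 0 ⊖ u) ⊛ shanks d N s ⊕ q^ (d * (suc s * N + (triangular s + suc s)))
        ≈⟨ ⊕-cong (⊛-congˡ≈ (q^ 0 ⊖ u) (shanks≈partialProduct d N B≤ s)) (q^-high (ℕ.≤-trans B≤ (ℕ.*-monoʳ-≤ d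
             (ℕ.≤-trans (ℕ.m≤m+n (suc N) (s * N + (triangular s + s))) (ℕ.≤-reflexive (exponent N s (triangular s))))))) ⟩
      (q^ 0 ⊖ u) ⊛ partialProduct d s ⊕ 0#
        ≈⟨ solve 1 (λ x → x :+ con 0ℤ := x) ≈-refl ((q^ 0 ⊖ u) ⊛ partialProduct d s) ⟩
      (q^ 0 ⊖ u) ⊛ partialProduct d s ∎
      where
      u = q^ (d * suc s)
      exponent : ∀ N s t → suc N + (s * N + (t + s)) ≡ suc s * N + (t + suc s)
      exponent = solve-∀

    partialProduct≈pentagonal : ∀ d N → B ≤ d * suc N →
      partialProduct d N ≈ qsum (λ k → d * pentagonal k) (integers N)
    partialProduct≈pentagonal d N B≤ =
      ≈-trans (≈-sym (shanks≈partialProduct d N B≤ N)) (shanks-pentagonal d N)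

  -- Lambert series and squares modulo 4.

  multiples : ℕ → ℕ → ℕ → PowerSeries
  multiples d i zero    = 0#
  multiples d i (suc J) = multiples d i J ⊕ q^ (d * (i * suc J))

  -- ∑_{i=1}^{N} ∑_{j=1}^{J} q^(d i j), a truncation of the Lambert series ∑ q^(d i) / (1 - q^(d i)).
  lambert : ℕ → ℕ → ℕ → PowerSeries
  lambert d zero    J = 0#
  lambert d (suc N) J = lambert d N J ⊕ multiples d (suc N) J

  two : PowerSeries
  two = embed (+ 2)

  squares : ℕ → ℕ → PowerSeries
  squares d N = qsum (λ y → d * (suc y * suc y)) (downFrom N)

  module Squares (B : ℕ) where

    open TruncatedProperties (+ 4) B
    open SetoidReasoning setoid
    open Solver

    geometric : ∀ d i J → (q^ 0 ⊖ q^ (d * i)) ⊛ multiples d i J ≈ q^ (d * i) ⊖ q^ (d * (i * suc J))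
    geometric d i zero = begin
      (q^ 0 ⊖ u) ⊛ 0#  ≈⟨ solve 1 (λ u → (con 1ℤ :- u) :* con 0ℤ := u :- u) ≈-refl u ⟩
      u ⊕ ⊝ u          ≈⟨ ⊕-congˡ u (⊝-cong (q^-cong (cong (d *_) (sym (ℕ.*-identityʳ i))))) ⟩
      u ⊖ q^ (d * (i * 1)) ∎
      where u = q^ (d * i)
    geometric d i (suc J) = begin
      (q^ 0 ⊖ u) ⊛ (multiples d i J ⊕ w)
        ≈⟨ solve 3 (λ u w g → (con 1ℤ :- u) :* (g :+ w) := (con 1ℤ :- u) :* g :+ (w :- u :* w)) ≈-refl
             u w (multiples d i J) ⟩
      (q^ 0 ⊖ u) ⊛ multiples d i J ⊕ (w ⊖ u ⊛ w)
        ≈⟨ ⊕-cong (geometric d i J) (⊕-congˡ w (⊝-cong (q^-⊛ (d * i) (d * (i * suc J)) (exponent d i J)))) ⟩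
      (u ⊖ w) ⊕ (w ⊖ w′)
        ≈⟨ solve 3 (λ u w w′ → (u :- w) :+ (w :- w′) := u :- w′) ≈-refl u w w′ ⟩
      u ⊖ w′ ∎
      where
      u = q^ (d * i)
      w = q^ (d * (i * suc J))
      w′ = q^ (d * (i * suc (suc J)))
      exponent : ∀ d i J → d * i + d * (i * suc J) ≡ d * (i * suc (suc J))
      exponent = solve-∀

    geometric-limit : ∀ d i J → B ≤ d * suc J →
      (q^ 0 ⊖ q^ (d * suc i)) ⊛ multiples d (suc i) J ≈ q^ (d * suc i)
    geometric-limit d i J B≤ = begin
      (q^ 0 ⊖ u) ⊛ multiples d (suc i) J
        ≈⟨ geometric d (suc i) J ⟩
      u ⊕ ⊝ (q^ (d * (suc i * suc J)))
        ≈⟨ ⊕-congˡ u (⊝-cong (q^-high (ℕ.≤-trans B≤ (ℕ.*-monoʳ-≤ d (ℕ.m≤m+n (suc J) (i * suc J)))))) ⟩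
      u ⊕ ⊝ 0#
        ≈⟨ solve 1 (λ u → u :- con 0ℤ := u) ≈-refl u ⟩
      u ∎
      where u = q^ (d * suc i)

    -- Each factor contributes (1 - u)² = (1 - u²) (1 - u) / (1 + u) ≡ (1 - u²) (1 + 2 u / (1 - u)).
    square≈lambert : ∀ d N J → B ≤ d * suc J →
      partialProduct d N ⊛ partialProduct d N ≈
      partialProduct (d + d) N ⊛ (q^ 0 ⊕ two ⊛ lambert d N J)
    square≈lambert d zero J B≤ =
      solve 0 (con 1ℤ :* con 1ℤ := con 1ℤ :* (con 1ℤ :+ con (+ 2) :* con 0ℤ)) ≈-refl
    square≈lambert d (suc N) J B≤ = begin
      ((q^ 0 ⊖ u) ⊛ P) ⊛ ((q^ 0 ⊖ u) ⊛ P)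
        ≈⟨ solve 2 (λ u p → ((con 1ℤ :- u) :* p) :* ((con 1ℤ :- u) :* p) :=
             ((con 1ℤ :- u) :* (con 1ℤ :- u)) :* (p :* p)) ≈-refl u P ⟩
      ((q^ 0 ⊖ u) ⊛ (q^ 0 ⊖ u)) ⊛ (P ⊛ P)
        ≈⟨ ⊛-congˡ≈ ((q^ 0 ⊖ u) ⊛ (q^ 0 ⊖ u)) (square≈lambert d N J B≤) ⟩
      ((q^ 0 ⊖ u) ⊛ (q^ 0 ⊖ u)) ⊛ (P₂ ⊛ (q^ 0 ⊕ two ⊛ L))
        -- The added multiple of 4 is what turns (1 - u)² (1 + 2 L) into (1 - u²) (1 + 2 L) + 2 (1 +
        -- u) u exactly. The last u is then traded for (1 - u) G, so that 1 - u² factors out without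
        -- any division.
        ≈⟨ drop-multiple (((q^ 0 ⊖ u) ⊛ (q^ 0 ⊖ u)) ⊛ (P₂ ⊛ (q^ 0 ⊕ two ⊛ L))) (P₂ ⊛ (u ⊕ L ⊛ (u ⊖ u ⊛ u))) ⟨
      ((q^ 0 ⊖ u) ⊛ (q^ 0 ⊖ u)) ⊛ (P₂ ⊛ (q^ 0 ⊕ two ⊛ L)) ⊕ embed (+ 4) ⊛ (P₂ ⊛ (u ⊕ L ⊛ (u ⊖ u ⊛ u)))
        ≈⟨ solve 3 (λ u p l →
             ((con 1ℤ :- u) :* (con 1ℤ :- u)) :* (p :* (con 1ℤ :+ con (+ 2) :* l)) :+
               con (+ 4) :* (p :* (u :+ l :* (u :- u :* u))) :=
             ((con 1ℤ :- u :* u) :* p) :* (con 1ℤ :+ con (+ 2) :* l) :+ con (+ 2) :* ((con 1ℤ :+ u) :* p) :* u)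
             ≈-refl u P₂ L ⟩
      ((q^ 0 ⊖ u ⊛ u) ⊛ P₂) ⊛ (q^ 0 ⊕ two ⊛ L) ⊕ two ⊛ ((q^ 0 ⊕ u) ⊛ P₂) ⊛ u
        ≈⟨ ⊕-congˡ (((q^ 0 ⊖ u ⊛ u) ⊛ P₂) ⊛ (q^ 0 ⊕ two ⊛ L))
             (⊛-congˡ≈ (two ⊛ ((q^ 0 ⊕ u) ⊛ P₂)) (geometric-limit d N J B≤)) ⟨
      ((q^ 0 ⊖ u ⊛ u) ⊛ P₂) ⊛ (q^ 0 ⊕ two ⊛ L) ⊕ two ⊛ ((q^ 0 ⊕ u) ⊛ P₂) ⊛ ((q^ 0 ⊖ u) ⊛ G)
        ≈⟨ solve 4 (λ u p l g →
             ((con 1ℤ :- u :* u) :* p) :* (con 1ℤ :+ con (+ 2) :* l) :+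
               con (+ 2) :* ((con 1ℤ :+ u) :* p) :* ((con 1ℤ :- u) :* g) :=
             ((con 1ℤ :- u :* u) :* p) :* (con 1ℤ :+ con (+ 2) :* (l :+ g))) ≈-refl u P₂ L G ⟩
      ((q^ 0 ⊖ u ⊛ u) ⊛ P₂) ⊛ (q^ 0 ⊕ two ⊛ (L ⊕ G))
        ≈⟨ ⊛-congʳ≈ (q^ 0 ⊕ two ⊛ (L ⊕ G)) (⊛-congʳ≈ P₂ (⊕-congˡ (q^ 0)
             (⊝-cong (q^-⊛ (d * suc N) (d * suc N) (sym (ℕ.*-distribʳ-+ (suc N) d d)))))) ⟩
      partialProduct (d + d) (suc N) ⊛ (q^ 0 ⊕ two ⊛ lambert d (suc N) J) ∎
      where
      u = q^ (d * suc N)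
      P = partialProduct d N
      P₂ = partialProduct (d + d) N
      L = lambert d N J
      G = multiples d (suc N) J

    -- By the symmetry of i j, enlarging the range of j adds the same kind of row as enlarging that
    -- of i; the square range can thus grow by one border at a time.
    lambert-sucʳ : ∀ d N J → lambert d N (suc J) ≈ lambert d N J ⊕ multiples d (suc J) N
    lambert-sucʳ d zero    J = solve 0 (con 0ℤ := con 0ℤ :+ con 0ℤ) ≈-refl
    lambert-sucʳ d (suc N) J = begin
      lambert d N (suc J) ⊕ (multiples d (suc N) J ⊕ q^ (d * (suc N * suc J)))
        ≈⟨ ⊕-cong (lambert-sucʳ d N J) (⊕-congˡ (multiples d (suc N) J)
             (q^-cong (cong (d *_) (ℕ.*-comm (suc N) (suc J))))) ⟩
      (lambert d N J ⊕ multiples d (suc J) N) ⊕ (multiples d (suc N) J ⊕ q^ (d * (suc J * suc N)))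
        ≈⟨ solve 4 (λ l g h w → (l :+ g) :+ (h :+ w) := (l :+ h) :+ (g :+ w)) ≈-refl
             (lambert d N J) (multiples d (suc J) N) (multiples d (suc N) J) (q^ (d * (suc J * suc N))) ⟩
      lambert d (suc N) J ⊕ multiples d (suc J) (suc N) ∎

    -- The terms q^(d i j) with i ≠ j pair up.
    lambert≈squares : ∀ d N → two ⊛ lambert d N N ≈ two ⊛ squares d N
    lambert≈squares d zero    = ≈-refl
    lambert≈squares d (suc N) = begin
      two ⊛ (lambert d N (suc N) ⊕ (g ⊕ w))
        ≈⟨ ⊛-congˡ≈ two (⊕-congʳ (g ⊕ w) (lambert-sucʳ d N N)) ⟩
      two ⊛ ((lambert d N N ⊕ g) ⊕ (g ⊕ w))
        ≈⟨ solve 3 (λ l g w → con (+ 2) :* ((l :+ g) :+ (g :+ w)) :=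
             (con (+ 2) :* l :+ con (+ 2) :* w) :+ con (+ 4) :* g) ≈-refl (lambert d N N) g w ⟩
      (two ⊛ lambert d N N ⊕ two ⊛ w) ⊕ embed (+ 4) ⊛ g
        ≈⟨ drop-multiple (two ⊛ lambert d N N ⊕ two ⊛ w) g ⟩
      two ⊛ lambert d N N ⊕ two ⊛ w
        ≈⟨ ⊕-congʳ (two ⊛ w) (lambert≈squares d N) ⟩
      two ⊛ squares d N ⊕ two ⊛ w
        ≈⟨ solve 2 (λ s w → con (+ 2) :* s :+ con (+ 2) :* w := con (+ 2) :* (w :+ s)) ≈-refl (squares d N) w ⟩
      two ⊛ (w ⊕ squares d N) ∎
      where
      g = multiples d (suc N) N
      w = q^ (d * (suc N * suc N))

    -- Inserting `E ⊛ E ≈ q^ 0` turns f₄ f₄ into (f₄ E)(f₄ E). One of these factors is f₂², which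
    -- cancels against the reciprocal.
    EOᵤ≈ : ∀ N → B ≤ suc N → EOᵤ ≈ f 4 ⊛ (q^ 0 ⊕ two ⊛ squares 2 N)
    EOᵤ≈ N B≤ = begin
      (f 4 ⊛ f 4) ⊛ I
        ≈⟨ solve 2 (λ a i → (a :* a) :* i := (a :* (a :* i)) :* con 1ℤ) ≈-refl (f 4) I ⟩
      (f 4 ⊛ (f 4 ⊛ I)) ⊛ q^ 0
        ≈⟨ ⊛-congˡ≈ (f 4 ⊛ (f 4 ⊛ I)) E²≈1 ⟨
      (f 4 ⊛ (f 4 ⊛ I)) ⊛ (E ⊛ E)
        ≈⟨ solve 3 (λ a i e → (a :* (a :* i)) :* (e :* e) := (a :* e) :* ((a :* e) :* i)) ≈-refl (f 4) I E ⟩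
      (f 4 ⊛ E) ⊛ ((f 4 ⊛ E) ⊛ I)
        ≈⟨ ⊛-congˡ≈ (f 4 ⊛ E) (⊛-congʳ≈ I f₂²≈) ⟨
      (f 4 ⊛ E) ⊛ ((f 2 ⊛ f 2) ⊛ I)
        ≈⟨ ⊛-congˡ≈ (f 4 ⊛ E) (≗⇒≈ (⊛-inverseʳ (f 2 ⊛ f 2) f₂²-constantTerm)) ⟩
      (f 4 ⊛ E) ⊛ q^ 0
        ≈⟨ solve 1 (λ a → a :* con 1ℤ := a) ≈-refl (f 4 ⊛ E) ⟩
      f 4 ⊛ E ∎
      where
      E = q^ 0 ⊕ two ⊛ squares 2 N
      I = (f 2 ⊛ f 2) ⁻¹
      E²≈1 : E ⊛ E ≈ q^ 0
      E²≈1 = begin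
        E ⊛ E
          ≈⟨ solve 1 (λ s → (con 1ℤ :+ con (+ 2) :* s) :* (con 1ℤ :+ con (+ 2) :* s) :=
               con 1ℤ :+ con (+ 4) :* (s :+ s :* s)) ≈-refl (squares 2 N) ⟩
        q^ 0 ⊕ embed (+ 4) ⊛ (squares 2 N ⊕ squares 2 N ⊛ squares 2 N)
          ≈⟨ drop-multiple (q^ 0) (squares 2 N ⊕ squares 2 N ⊛ squares 2 N) ⟩
        q^ 0 ∎
      f₂≈ = f≈partialProduct 2 B≤
      f₂²≈ : f 2 ⊛ f 2 ≈ f 4 ⊛ E
      f₂²≈ = begin
        f 2 ⊛ f 2
          ≈⟨ ⊛-cong≈ f₂≈ f₂≈ ⟩
        partialProduct 2 N ⊛ partialProduct 2 N
          ≈⟨ square≈lambert 2 N N (ℕ.≤-trans B≤ (ℕ.m≤m+n (suc N) (1 * suc N))) ⟩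
        partialProduct 4 N ⊛ (q^ 0 ⊕ two ⊛ lambert 2 N N)
          ≈⟨ ⊛-cong≈ (≈-sym (f≈partialProduct 4 B≤)) (⊕-congˡ (q^ 0) (lambert≈squares 2 N)) ⟩
        f 4 ⊛ E ∎

  -- The coefficients of `EOᵤ` as numbers of representations.

  neg-⊛ : ∀ a b n → (⊝ a ⊛ b) n ≡ -ℤ (a ⊛ b) n
  neg-⊛ a b n = trans (⊛-congʳ b (λ i → sym (ℤ.-1*i≡-i (a i))) n)
    (trans (⊛-scaleˡ (-ℤ 1ℤ) a b n) (ℤ.-1*i≡-i ((a ⊛ b) n)))

  -- Used with `k = 4`: f₄ has no term in q^(4 n + 2), so the 1 in 1 + 2 ∑ q^(2 y²) contributes
  -- nothing to `EOᵤ (4 * n + 2)`.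
  partialProduct-support : ∀ k N {n} → ¬ k ∣ n → partialProduct k N n ≡ 0ℤ
  partialProduct-support k zero    {zero}  k∤n = contradiction (k ℕ∣.∣0) k∤n
  partialProduct-support k zero    {suc n} k∤n = refl
  partialProduct-support k (suc N) {n}     k∤n = begin
    ((q^ 0 ⊖ q^ e) ⊛ P) n               ≡⟨ ⊛-distribʳ P (q^ 0) (⊝ (q^ e)) n ⟩
    (q^ 0 ⊛ P) n +ℤ (⊝ (q^ e) ⊛ P) n    ≡⟨ cong₂ _+ℤ_ (trans (⊛-identityˡ P n) (partialProduct-support k N k∤n))
                                             (trans (neg-⊛ (q^ e) P n) (cong -ℤ_ shifted≡0)) ⟩
    0ℤ                                  ∎
    where
    open ≡-Reasoning
    e = k * suc N
    P = partialProduct k N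
    shifted≡0 : (q^ e ⊛ P) n ≡ 0ℤ
    shifted≡0 with e ℕ.≤? n
    ... | no e≰n  = q^-⊛-< P (ℕ.≰⇒> e≰n)
    ... | yes e≤n with j , refl ← ℕ.m≤n⇒∃[o]m+o≡n e≤n =
      trans (q^-⊛-+ e P j) (partialProduct-support k N
        (λ k∣j → k∤n (ℕ∣.∣m∣n⇒∣m+n (ℕ∣.m∣m*n (suc N)) k∣j)))

  weight : ℤ × ℕ → ℕ
  weight (k , y) = 4 * pentagonal k + 2 * (suc y * suc y)

  weightIs : ∀ c x → Dec (weight x ≡ c)
  weightIs c x = weight x ℕ.≟ c

  representations : ℕ → List (ℤ × ℕ)
  representations c = filter (weightIs c) (cartesianProduct (integers c) (downFrom c))

  -- Only `2 (f 4 ⊛ Φ) c` survives at `c`, so the factor `f 4 ⊛ Φ` matters just modulo 2, and the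
  -- pentagonal series without its signs suffices. Since only coefficients up to `c` enter, the
  -- truncation is at `suc c` and all ranges stop at `c`.
  EOᵤ-count : ∀ n → (+ 4) ∣ℤ (EOᵤ (4 * n + 2) -ℤ (+ 2) *ℤ (+ length (representations (4 * n + 2))))
  EOᵤ-count n = combine (Squares.EOᵤ≈ (suc c) c ℕ.≤-refl) parity
    where
    c = 4 * n + 2
    module T₄ = TruncatedProperties (+ 4) (suc c)
    module T₂ = TruncatedProperties (+ 2) (suc c)
    Φ = squares 2 c
    r = + length (representations c)
    4∤c : ¬ 4 ∣ c
    4∤c 4∣c = case ℕ∣.∣m+n∣m⇒∣n 4∣c (ℕ∣.m∣m*n n) of λ 4∣2 → contradiction (ℕ∣.∣⇒≤ 4∣2) λ { (s≤s (s≤s ())) }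
    split : (f 4 ⊛ (q^ 0 ⊕ two ⊛ Φ)) c ≡ (+ 2) *ℤ (f 4 ⊛ Φ) c
    split = begin
      (f 4 ⊛ (q^ 0 ⊕ two ⊛ Φ)) c                   ≡⟨ ⊛-comm (f 4) (q^ 0 ⊕ two ⊛ Φ) c ⟩
      ((q^ 0 ⊕ two ⊛ Φ) ⊛ f 4) c                   ≡⟨ ⊛-distribʳ (f 4) (q^ 0) (two ⊛ Φ) c ⟩
      (q^ 0 ⊛ f 4) c +ℤ ((two ⊛ Φ) ⊛ f 4) c        ≡⟨ cong₂ _+ℤ_ (trans (⊛-identityˡ (f 4) c) (partialProduct-support 4 c 4∤c))
                                                        (trans (⊛-assoc two Φ (f 4) c) (embed-⊛ (+ 2) (Φ ⊛ f 4) c)) ⟩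
      0ℤ +ℤ (+ 2) *ℤ (Φ ⊛ f 4) c                   ≡⟨ ℤ.+-identityˡ _ ⟩
      (+ 2) *ℤ (Φ ⊛ f 4) c                         ≡⟨ cong ((+ 2) *ℤ_) (⊛-comm Φ (f 4) c) ⟩
      (+ 2) *ℤ (f 4 ⊛ Φ) c                         ∎
      where open ≡-Reasoning
    f₄≈ : f 4 T₂.≈ qsum (λ k → 4 * pentagonal k) (integers c)
    f₄≈ = T₂.≈-trans (T₂.f≈partialProduct 4 ℕ.≤-refl)
      (Pentagonal.partialProduct≈pentagonal (suc c) 4 c (ℕ.m≤m+n (suc c) (3 * suc c)))
    parity : (+ 2) ∣ℤ ((f 4 ⊛ Φ) c -ℤ r)
    parity = subst (λ x → (+ 2) ∣ℤ ((f 4 ⊛ Φ) c -ℤ x))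
      (trans (qsum-⊛ (λ k → 4 * pentagonal k) (λ y → 2 * (suc y * suc y)) (integers c) (downFrom c) c)
        (qsum-coeff weight (cartesianProduct (integers c) (downFrom c)) c))
      (T₂.coeff (T₂.⊛-congʳ≈ Φ f₄≈) c ℕ.≤-refl)
    combine : EOᵤ T₄.≈ f 4 ⊛ (q^ 0 ⊕ two ⊛ Φ) → (+ 2) ∣ℤ ((f 4 ⊛ Φ) c -ℤ r) →
            (+ 4) ∣ℤ (EOᵤ c -ℤ (+ 2) *ℤ r)
    combine EO≈ (divides h eq) with divides g eq′ ← T₄.coeff EO≈ c ℕ.≤-refl = divides (g +ℤ h) (begin
      EOᵤ c -ℤ (+ 2) *ℤ r
        ≡⟨ regroup (EOᵤ c) ((f 4 ⊛ Φ) c) r ⟩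
      (EOᵤ c -ℤ (+ 2) *ℤ (f 4 ⊛ Φ) c) +ℤ (+ 2) *ℤ ((f 4 ⊛ Φ) c -ℤ r)
        ≡⟨ cong₂ (λ x y → (EOᵤ c -ℤ x) +ℤ (+ 2) *ℤ y) (sym split) eq ⟩
      (EOᵤ c -ℤ (f 4 ⊛ (q^ 0 ⊕ two ⊛ Φ)) c) +ℤ (+ 2) *ℤ (h *ℤ (+ 2))
        ≡⟨ cong (_+ℤ (+ 2) *ℤ (h *ℤ (+ 2))) eq′ ⟩
      g *ℤ (+ 4) +ℤ (+ 2) *ℤ (h *ℤ (+ 2))
        ≡⟨ regroup′ g h ⟩
      (g +ℤ h) *ℤ (+ 4) ∎)
      where
      open ≡-Reasoning
      regroup : ∀ x s r → x -ℤ (+ 2) *ℤ r ≡ (x -ℤ (+ 2) *ℤ s) +ℤ (+ 2) *ℤ (s -ℤ r)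
      regroup = ℤRing.solve-∀
      regroup′ : ∀ g h → g *ℤ (+ 4) +ℤ (+ 2) *ℤ (h *ℤ (+ 2)) ≡ (g +ℤ h) *ℤ (+ 4)
      regroup′ = ℤRing.solve-∀

-- Counting with duplicate-free lists.

module QuadraticForm where

  open EtaQuotient
  open import Data.Fin.Base as Fin using (Fin; fromℕ<)
  open import Data.Fin.Properties as Fin using (all?; toℕ-fromℕ<)
  open import Data.Integer.Base as ℤ using (ℤ; 0ℤ; 1ℤ; +_; -[1+_]; _+_; _-_; _*_; -_; _<_; +<+) renaming (∣_∣ to abs)
  open import Data.Integer.DivMod using (_/ℕ_; a≡a%ℕn+[a/ℕn]*n; n%ℕd<d)
  open import Data.Integer.Divisibility.Signed
  import Data.Integer.Properties as ℤ
  open import Algebra.Properties.AbelianGroup ℤ.+-0-abelianGroup using (∙-cancelˡ; ∙-cancelʳ)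
  open import Data.Integer.Tactic.RingSolver using (solve-∀)
  open import Data.List.Base using (List; []; _∷_; _++_; map; filter; length; cartesianProduct; downFrom)
  open import Data.List.Membership.Propositional using (_∈_)
  open import Data.List.Membership.Propositional.Properties
  open import Data.List.Properties using (length-map; length-++; length-++-sucʳ)
  open import Data.List.Relation.Binary.Disjoint.Propositional using (Disjoint)
  open import Data.List.Relation.Unary.All as All using (All; []; _∷_)
  open import Data.List.Relation.Unary.Any using (here; there)
  open import Data.List.Relation.Unary.Unique.Propositional using (Unique; []; _∷_)
  open import Data.List.Relation.Unary.Unique.Propositional.Properties as Unique using ()
  open import Data.Nat.Base as ℕ using (ℕ; zero; suc; NonZero; z≤n; s≤s)
  import Data.Nat.Divisibility as ℕ
  open import Data.Nat.Primality using (Prime; euclidsLemma)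
  import Data.Nat.Properties as ℕ
  import Data.Nat.Tactic.RingSolver as ℕRing
  open import Data.Product.Base using (_×_; _,_; proj₁; proj₂; ∃-syntax)
  open import Data.Sum.Base using (_⊎_; inj₁; inj₂; [_,_]′)
  open import Function.Base using (_∘_; case_of_)
  open import Relation.Binary.PropositionalEquality
  open import Relation.Nullary
  open import Relation.Nullary.Decidable using (_→-dec_; _×-dec_; ¬?)
  open import Relation.Binary.Definitions using (tri<; tri≈; tri>)
  open import Relation.Unary using (Decidable)

  private variable
    A B : Set

  length-injection : {xs : List A} {ys : List B} → Unique xs → (g : A → B) →
                     (∀ {x} → x ∈ xs → g x ∈ ys) →
                     (∀ {x x′} → x ∈ xs → x′ ∈ xs → g x ≡ g x′ → x ≡ x′) →
                     length xs ℕ.≤ length ys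
  length-injection []               g g∈ inj = z≤n
  length-injection (x∉ ∷ unique) g g∈ inj with us , vs , refl ← ∈-∃++ (g∈ (here refl)) =
    ℕ.≤-trans (s≤s (length-injection unique g g∈′ (λ p q → inj (there p) (there q))))
      (ℕ.≤-reflexive (sym (length-++-sucʳ us _ vs)))
    where
    g∈′ : ∀ {y} → y ∈ _ → g y ∈ us ++ vs
    g∈′ {y} y∈ with ∈-++⁻ us (g∈ (there y∈))
    ... | inj₁ p          = ∈-++⁺ˡ p
    ... | inj₂ (there p)  = ∈-++⁺ʳ us p
    ... | inj₂ (here eq)  = contradiction (inj (here refl) (there y∈) (sym eq)) (All.lookup x∉ y∈)

  length-filter-¬ : {P : A → Set} (P? : Decidable P) (xs : List A) →
                    length (filter P? xs) ℕ.+ length (filter (¬? ∘ P?) xs) ≡ length xs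
  length-filter-¬ P? [] = refl
  length-filter-¬ P? (x ∷ xs) with P? x
  ... | yes _ = cong suc (length-filter-¬ P? xs)
  ... | no  _ = trans (ℕ.+-suc _ _) (cong suc (length-filter-¬ P? xs))

  -- Makes `length xs` the cardinality of `P`, so that counts are compared through predicates,
  -- independently of how a list was produced.
  record Enumerates {A : Set} (xs : List A) (P : A → Set) : Set where
    field
      unique   : Unique xs
      sound    : ∀ {x} → x ∈ xs → P x
      complete : ∀ {x} → P x → x ∈ xs
  open Enumerates

  length-≡ : {P : A → Set} {xs ys : List A} → Enumerates xs P → Enumerates ys P → length xs ≡ length ys
  length-≡ e e′ = ℕ.≤-antisym
    (length-injection (unique e) (λ x → x) (complete e′ ∘ sound e) (λ _ _ eq → eq))
    (length-injection (unique e′) (λ x → x) (complete e ∘ sound e′) (λ _ _ eq → eq))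

  Even : ℕ → Set
  Even n = ∃[ h ] n ≡ h ℕ.+ h

  -- `τ` matches the elements satisfying `Q` with those that do not, so the two halves have equal
  -- length. `Q` selects one element from each orbit.
  even-length : {P Q : A → Set} {xs : List A} → Enumerates xs P → (Q? : Decidable Q) (τ : A → A) →
                (∀ {x} → P x → P (τ x)) → (∀ {x} → P x → τ (τ x) ≡ x) →
                (∀ {x} → P x → Q x → ¬ Q (τ x)) → (∀ {x} → P x → ¬ Q x → Q (τ x)) →
                Even (length xs)
  even-length {P = P} {xs = xs} e Q? τ τ-closed τ-involutive Q⇒¬Q ¬Q⇒Q =
    length (filter Q? xs) ,
    trans (sym (length-filter-¬ Q? xs)) (cong (length (filter Q? xs) ℕ.+_) (ℕ.≤-antisym
      (length-injection (Unique.filter⁺ (¬? ∘ Q?) (unique e)) τ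
        (λ x∈ → let x∈xs , ¬q = ∈-filter⁻ (¬? ∘ Q?) x∈ in
          ∈-filter⁺ Q? (complete e (τ-closed (sound e x∈xs))) (¬Q⇒Q (sound e x∈xs) ¬q))
        (λ x∈ y∈ → τ-injective (proj₁ (∈-filter⁻ (¬? ∘ Q?) x∈)) (proj₁ (∈-filter⁻ (¬? ∘ Q?) y∈))))
      (length-injection (Unique.filter⁺ Q? (unique e)) τ
        (λ x∈ → let x∈xs , q = ∈-filter⁻ Q? x∈ in
          ∈-filter⁺ (¬? ∘ Q?) (complete e (τ-closed (sound e x∈xs))) (Q⇒¬Q (sound e x∈xs) q))
        (λ x∈ y∈ → τ-injective (proj₁ (∈-filter⁻ Q? x∈)) (proj₁ (∈-filter⁻ Q? y∈))))))
    where
    τ-injective : ∀ {x y} → x ∈ xs → y ∈ xs → τ x ≡ τ y → x ≡ y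
    τ-injective x∈ y∈ eq =
      trans (sym (τ-involutive (sound e x∈))) (trans (cong τ eq) (τ-involutive (sound e y∈)))

  -- Representations by the form x² + 12 y².

  Point : Set
  Point = ℤ × ℤ

  norm : Point → ℤ
  norm (x , y) = x * x + + 12 * (y * y)

  -- Requiring x ≡ 1 (mod 6) picks one of the two signs of an x coprime to 6.
  record Admissible (v : Point) : Set where
    constructor _,_
    field
      6∣x-1 : + 6 ∣ proj₁ v - 1ℤ
      0<y   : 0ℤ < proj₂ v

  2∤1 : ∀ a b → 1ℤ + + 2 * a ≢ + 2 * b
  2∤1 a b eq = case ℕ.∣⇒≤ (∣⇒∣ᵤ (divides {+ 2} {1ℤ} (b - a) (trans (isolate a) (trans (cong (_- + 2 * a) eq) (factor a b))))) of
    λ { (s≤s ()) }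
    where
    isolate : ∀ a → 1ℤ ≡ (1ℤ + + 2 * a) - + 2 * a
    isolate = solve-∀
    factor : ∀ a b → + 2 * b - + 2 * a ≡ (b - a) * + 2
    factor = solve-∀

  triangular-double : ∀ n → 2 ℕ.* triangular n ≡ n ℕ.* suc n
  triangular-double zero    = refl
  triangular-double (suc n) = trans (ℕ.*-distribˡ-+ 2 (triangular n) (suc n))
    (trans (cong (ℕ._+ 2 ℕ.* suc n) (triangular-double n)) (step n))
    where
    step : ∀ n → n ℕ.* suc n ℕ.+ 2 ℕ.* suc n ≡ suc n ℕ.* suc (suc n)
    step = ℕRing.solve-∀

  pentagonal-double : ∀ k → + 2 * + pentagonal k ≡ k * (+ 3 * k + 1ℤ)
  pentagonal-double (+ n) = begin
    + 2 * + (n ℕ.* n ℕ.+ triangular n)         ≡⟨ cong (+ 2 *_) (trans (ℤ.pos-+ (n ℕ.* n) (triangular n)) (cong (_+ + triangular n) (ℤ.pos-* n n))) ⟩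
    + 2 * (+ n * + n + + triangular n)         ≡⟨ ℤ.*-distribˡ-+ (+ 2) (+ n * + n) (+ triangular n) ⟩
    + 2 * (+ n * + n) + + 2 * + triangular n   ≡⟨ cong (λ t → + 2 * (+ n * + n) + t)
                                                   (trans (sym (ℤ.pos-* 2 (triangular n))) (trans (cong +_ (triangular-double n)) (ℤ.pos-* n (suc n)))) ⟩
    + 2 * (+ n * + n) + + n * (1ℤ + + n)       ≡⟨ final (+ n) ⟩
    + n * (+ 3 * + n + 1ℤ)                     ∎
    where
    open ≡-Reasoning
    final : ∀ x → + 2 * (x * x) + x * (1ℤ + x) ≡ x * (+ 3 * x + 1ℤ)
    final = solve-∀
  pentagonal-double -[1+ n ] = begin
    + 2 * + (suc n ℕ.* suc n ℕ.+ triangular n)               ≡⟨ cong (+ 2 *_) (trans (ℤ.pos-+ (suc n ℕ.* suc n) (triangular n)) (cong (_+ + triangular n) (ℤ.pos-* (suc n) (suc n)))) ⟩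
    + 2 * ((1ℤ + + n) * (1ℤ + + n) + + triangular n)         ≡⟨ ℤ.*-distribˡ-+ (+ 2) ((1ℤ + + n) * (1ℤ + + n)) (+ triangular n) ⟩
    + 2 * ((1ℤ + + n) * (1ℤ + + n)) + + 2 * + triangular n   ≡⟨ cong (λ t → + 2 * ((1ℤ + + n) * (1ℤ + + n)) + t)
                                                   (trans (sym (ℤ.pos-* 2 (triangular n))) (trans (cong +_ (triangular-double n)) (ℤ.pos-* n (suc n)))) ⟩
    + 2 * ((1ℤ + + n) * (1ℤ + + n)) + + n * (1ℤ + + n)       ≡⟨ final (+ n) ⟩
    (- (1ℤ + + n)) * (+ 3 * (- (1ℤ + + n)) + 1ℤ)             ∎
    where
    open ≡-Reasoning
    final : ∀ x → + 2 * ((1ℤ + x) * (1ℤ + x)) + x * (1ℤ + x) ≡ (- (1ℤ + x)) * (+ 3 * (- (1ℤ + x)) + 1ℤ)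
    final = solve-∀

  point : ℤ × ℕ → Point
  point (k , y) = + 6 * k + 1ℤ , + suc y

  -- Completing the square: 24 times the pentagonal number k (3 k + 1) / 2 is (6 k + 1)² - 1.
  norm-point : ∀ v → norm (point v) ≡ 1ℤ + + 6 * + weight v
  norm-point (k , y) = begin
    (+ 6 * k + 1ℤ) * (+ 6 * k + 1ℤ) + + 12 * (+ suc y * + suc y)
      ≡⟨ expand k (+ suc y) ⟩
    1ℤ + (+ 12 * (k * (+ 3 * k + 1ℤ)) + + 12 * (+ suc y * + suc y))
      ≡⟨ cong (λ t → 1ℤ + (+ 12 * t + + 12 * (+ suc y * + suc y))) (sym (pentagonal-double k)) ⟩
    1ℤ + (+ 12 * (+ 2 * + pentagonal k) + + 12 * (+ suc y * + suc y))
      ≡⟨ collect (+ pentagonal k) (+ suc y) ⟩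
    1ℤ + + 6 * (+ 4 * + pentagonal k + + 2 * (+ suc y * + suc y))
      ≡⟨ cong (λ t → 1ℤ + + 6 * t) (sym (trans (ℤ.pos-+ (4 ℕ.* pentagonal k) (2 ℕ.* (suc y ℕ.* suc y)))
           (cong₂ _+_ (ℤ.pos-* 4 (pentagonal k))
             (trans (ℤ.pos-* 2 (suc y ℕ.* suc y)) (cong (+ 2 *_) (ℤ.pos-* (suc y) (suc y))))))) ⟩
    1ℤ + + 6 * + weight (k , y) ∎
    where
    open ≡-Reasoning
    expand : ∀ k y → (+ 6 * k + 1ℤ) * (+ 6 * k + 1ℤ) + + 12 * (y * y) ≡
                     1ℤ + (+ 12 * (k * (+ 3 * k + 1ℤ)) + + 12 * (y * y))
    expand = solve-∀
    collect : ∀ t y → 1ℤ + (+ 12 * (+ 2 * t) + + 12 * (y * y)) ≡ 1ℤ + + 6 * (+ 4 * t + + 2 * (y * y))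
    collect = solve-∀

  ∈-integers⁻ : ∀ {k} N → k ∈ integers N → abs k ℕ.≤ N
  ∈-integers⁻ zero    (here refl)         = z≤n
  ∈-integers⁻ (suc N) (here refl)         = ℕ.≤-refl
  ∈-integers⁻ (suc N) (there (here refl)) = ℕ.≤-refl
  ∈-integers⁻ (suc N) (there (there k∈))  = ℕ.m≤n⇒m≤1+n (∈-integers⁻ N k∈)

  ∈-integers⁺ : ∀ k N → abs k ℕ.≤ N → k ∈ integers N
  ∈-integers⁺ (+ zero) zero    z≤n = here refl
  ∈-integers⁺ k        (suc N) k≤  with abs k ℕ.≟ suc N
  ∈-integers⁺ k        (suc N) k≤ | no k≢   = there (there (∈-integers⁺ k N (ℕ.≤-pred (ℕ.≤∧≢⇒< k≤ k≢))))
  ∈-integers⁺ (+ _)    (suc N) k≤ | yes refl = here refl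
  ∈-integers⁺ -[1+ _ ] (suc N) k≤ | yes refl = there (here refl)

  integers-unique : ∀ N → Unique (integers N)
  integers-unique zero    = [] ∷ []
  integers-unique (suc N) = ((λ ()) ∷ fresh ℕ.≤-refl) ∷ (fresh ℕ.≤-refl ∷ integers-unique N)
    where
    fresh : ∀ {k} → N ℕ.< abs k → All (k ≢_) (integers N)
    fresh N<k = All.tabulate λ { j∈ refl → ℕ.<⇒≱ N<k (∈-integers⁻ N j∈) }

  ∣k∣≤pentagonal : ∀ k → abs k ℕ.≤ pentagonal k
  ∣k∣≤pentagonal (+ zero)  = z≤n
  ∣k∣≤pentagonal (+ suc n) = ℕ.≤-trans (ℕ.m≤m*n (suc n) (suc n)) (ℕ.m≤m+n _ _)
  ∣k∣≤pentagonal -[1+ n ]  = ℕ.≤-trans (ℕ.m≤m*n (suc n) (suc n)) (ℕ.m≤m+n _ _)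

  Represents : ℤ → Point → Set
  Represents N v = Admissible v × norm v ≡ N

  -- The finite box searched by `representations` misses no solution: `pentagonal k` is at least
  -- `abs k`, and the square of `suc y` exceeds y, so weight `c` forces `abs k ≤ c` and y < c.
  representations-enumerates : ∀ c →
    Enumerates (map point (representations c)) (Represents (1ℤ + + 6 * + c))
  representations-enumerates c = record
    { unique   = Unique.map⁺ point-injective (Unique.filter⁺ (weightIs c)
                   (Unique.cartesianProduct⁺ (integers-unique c) (Unique.downFrom⁺ c)))
    ; sound    = λ v∈ → case ∈-map⁻ point v∈ of λ
        { ((k , y) , u∈ , refl) →
            (divides k (residue k) , +<+ (s≤s z≤n)) ,
            trans (norm-point (k , y)) (cong (λ t → 1ℤ + + 6 * + t) (proj₂ (∈-filter⁻ (weightIs c) {xs = pairs} u∈))) }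
    ; complete = λ { (adm , eq) → complete′ adm eq }
    }
    where
    pairs = cartesianProduct (integers c) (downFrom c)
    point-injective : ∀ {u v} → point u ≡ point v → u ≡ v
    point-injective {k , y} {k′ , y′} eq = cong₂ _,_
      (ℤ.*-cancelˡ-≡ (+ 6) k k′ (∙-cancelʳ 1ℤ (+ 6 * k) (+ 6 * k′) (cong proj₁ eq)))
      (ℕ.suc-injective (ℤ.+-injective (cong proj₂ eq)))
    residue : ∀ k → (+ 6 * k + 1ℤ) - 1ℤ ≡ k * + 6
    residue = solve-∀
    restore : ∀ x → x ≡ (x - 1ℤ) + 1ℤ
    restore = solve-∀
    swap6 : ∀ k → k * + 6 + 1ℤ ≡ + 6 * k + 1ℤ
    swap6 = solve-∀
    complete″ : ∀ k y → norm (point (k , y)) ≡ 1ℤ + + 6 * + c → point (k , y) ∈ map point (representations c)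
    complete″ k y eq = ∈-map⁺ point (∈-filter⁺ (weightIs c) (∈-cartesianProduct⁺
        (∈-integers⁺ k c (ℕ.≤-trans (∣k∣≤pentagonal k) (ℕ.≤-trans (ℕ.m≤n*m (pentagonal k) 4)
          (ℕ.≤-trans (ℕ.m≤m+n _ _) (ℕ.≤-reflexive weight≡)))))
        (∈-downFrom⁺ (ℕ.≤-trans (ℕ.m≤m*n (suc y) (suc y)) (ℕ.≤-trans (ℕ.m≤n*m (suc y ℕ.* suc y) 2)
          (ℕ.≤-trans (ℕ.m≤n+m _ _) (ℕ.≤-reflexive weight≡))))))
      weight≡)
      where
      weight≡ : weight (k , y) ≡ c
      weight≡ = ℤ.+-injective (ℤ.*-cancelˡ-≡ (+ 6) _ _ (∙-cancelˡ 1ℤ _ _ (trans (sym (norm-point (k , y))) eq)))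
    complete′ : ∀ {v} → Admissible v → norm v ≡ 1ℤ + + 6 * + c → v ∈ map point (representations c)
    complete′ {x , + suc y} (divides k eq , _) eq′
      with refl ← trans (restore x) (trans (cong (_+ 1ℤ) eq) (swap6 k)) = complete″ k y eq′
    complete′ {x , + zero}   (_ , +<+ ()) _
    complete′ {x , -[1+ _ ]} (_ , ()) _

  euclidsLemma-ℤ : ∀ {p} → Prime p → ∀ a b → + p ∣ a * b → + p ∣ a ⊎ + p ∣ b
  euclidsLemma-ℤ p-prime a b p∣ab =
    case euclidsLemma (abs a) (abs b) p-prime (subst (_ ℕ.∣_) (ℤ.abs-* a b) (∣⇒∣ᵤ p∣ab)) of λ
      { (inj₁ p∣a) → inj₁ (∣ᵤ⇒∣ p∣a)
      ; (inj₂ p∣b) → inj₂ (∣ᵤ⇒∣ p∣b) }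

  cancel-∤ : ∀ {p} → Prime p → ∀ a b → ¬ + p ∣ a → + p ∣ a * b → + p ∣ b
  cancel-∤ p-prime a b p∤a p∣ab = case euclidsLemma-ℤ p-prime a b p∣ab of λ
    { (inj₁ p∣a) → contradiction p∣a p∤a
    ; (inj₂ p∣b) → p∣b }

  0<-cancelˡ : ∀ p y → 0ℤ < + p * y → 0ℤ < y
  0<-cancelˡ p y 0<py = ℤ.*-cancelˡ-<-nonNeg (+ p) (subst (_< + p * y) (sym (ℤ.*-zeroʳ (+ p))) 0<py)

  0<-* : ∀ p .{{_ : NonZero p}} {y} → 0ℤ < y → 0ℤ < + p * y
  0<-* (suc p) {+ suc y} _ = +<+ (s≤s z≤n)
  0<-* (suc p) {+ zero} (+<+ ())

  -- The points (x / p , y / p), up to signs, for those (x , y) of norm p M with p ∣ x and p ∣ y.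
  Quotient : ℕ → ℤ → Point → Set
  Quotient p M v = Admissible v × + p * norm v ≡ M

  -- The common interface of inert and split primes. `Quotient` multiplies the norm by p rather than
  -- dividing M, so it is simply empty when p does not divide M.
  Pairing : ℕ → ℤ → Set
  Pairing p M = ∀ {xs us} → Enumerates xs (Represents (+ p * M)) → Enumerates us (Quotient p M) →
                Even (length xs ℕ.+ length us)

  -- Inert primes.

  module Inert (p : ℕ) .{{_ : NonZero p}} (6∣p+1 : + 6 ∣ + p + 1ℤ)
    (inert : ∀ x y → + p ∣ norm (x , y) → + p ∣ x × + p ∣ y) where

    private
      P = + p
      instance
        P≢0 : ℤ.NonZero P
        P≢0 = ℕ.≢-nonZero (ℕ.≢-nonZero⁻¹ p)

    -- As p ≡ -1 (mod 6), the minus sign keeps the first coordinate ≡ 1 (mod 6).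
    scale- : Point → Point
    scale- (x , y) = - (P * x) , P * y

    norm-scale- : ∀ v → norm (scale- v) ≡ P * (P * norm v)
    norm-scale- (x , y) = identity P x y
      where
      identity : ∀ P x y → (- (P * x)) * (- (P * x)) + + 12 * ((P * y) * (P * y)) ≡
                           P * (P * (x * x + + 12 * (y * y)))
      identity = solve-∀

    pairing : ∀ M → Pairing p M
    pairing M {xs} {us} exs eus = length us , cong (ℕ._+ length us)
      (trans (length-≡ exs enumeration) (length-map scale- us))
      where
      scale-injective : ∀ {u v} → scale- u ≡ scale- v → u ≡ v
      scale-injective {x , y} {x′ , y′} eq = cong₂ _,_
        (ℤ.*-cancelˡ-≡ P x x′ (ℤ.neg-injective (cong proj₁ eq)))
        (ℤ.*-cancelˡ-≡ P y y′ (cong proj₂ eq))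
      residue : ∀ P x → (- (P * x)) - 1ℤ ≡ (x - 1ℤ) - (P + 1ℤ) * x
      residue = solve-∀
      residue′ : ∀ P x → x - 1ℤ ≡ ((- (P * x)) - 1ℤ) + (P + 1ℤ) * x
      residue′ = solve-∀
      reorder : ∀ P z → z * P ≡ - (P * (- z))
      reorder = solve-∀
      sound′ : ∀ {v} → Quotient p M v → Represents (P * M) (scale- v)
      sound′ {x , y} ((6∣ , 0<y) , eq) =
        (subst (+ 6 ∣_) (sym (residue P x)) (∣m∣n⇒∣m-n 6∣ (∣m⇒∣m*n x 6∣p+1)) , 0<-* p 0<y) ,
        trans (norm-scale- (x , y)) (cong (P *_) eq)
      complete″ : ∀ x y → Represents (P * M) (scale- (x , y)) → scale- (x , y) ∈ map scale- us
      complete″ x y ((6∣ , 0<py) , eq) = ∈-map⁺ scale- (complete eus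
        ((subst (+ 6 ∣_) (sym (residue′ P x)) (∣m∣n⇒∣m+n 6∣ (∣m⇒∣m*n x 6∣p+1)) , 0<-cancelˡ p y 0<py) ,
         ℤ.*-cancelˡ-≡ P _ _ (trans (sym (norm-scale- (x , y))) eq)))
      complete′ : ∀ {v} → Represents (P * M) v → v ∈ map scale- us
      complete′ {x , y} r with inert x y (subst (P ∣_) (sym (proj₂ r)) (∣m⇒∣m*n M ∣-refl))
      ... | divides x′ eqx , divides y′ eqy =
        subst (_∈ map scale- us) (sym eq) (complete″ (- x′) y′ (subst (Represents (P * M)) eq r))
        where
        eq : (x , y) ≡ scale- (- x′ , y′)
        eq = cong₂ _,_ (trans eqx (reorder P x′)) (trans eqy (ℤ.*-comm y′ P))
      enumeration : Enumerates (map scale- us) (Represents (P * M))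
      enumeration = record
        { unique   = Unique.map⁺ scale-injective (unique eus)
        ; sound    = λ v∈ → case ∈-map⁻ scale- v∈ of λ { (u , u∈ , refl) → sound′ (sound eus u∈) }
        ; complete = complete′
        }

  -- A decidable form of the fact that -12 is not a square modulo p: the norm modulo p depends only
  -- on residues, so running through all pairs of them replaces quadratic reciprocity.
  InertCheck : ℕ → Set
  InertCheck p = (i j : Fin p) → p ℕ.∣ Fin.toℕ i ℕ.* Fin.toℕ i ℕ.+ 12 ℕ.* (Fin.toℕ j ℕ.* Fin.toℕ j) →
                 Fin.toℕ i ≡ 0 × Fin.toℕ j ≡ 0

  inertCheck? : ∀ p → Dec (InertCheck p)
  inertCheck? p = all? λ i → all? λ j → (_ ℕ.∣? _) →-dec ((_ ℕ.≟ _) ×-dec (_ ℕ.≟ _))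

  inertCheck⇒inert : ∀ p .{{_ : NonZero p}} → InertCheck p →
                     ∀ x y → + p ∣ norm (x , y) → + p ∣ x × + p ∣ y
  inertCheck⇒inert p check x y p∣norm = divisible x (proj₁ zeros) , divisible y (proj₂ zeros)
    where
    rem : ℤ → Fin p
    rem x = fromℕ< (n%ℕd<d x p)
    rem-spec : ∀ x → x ≡ + Fin.toℕ (rem x) + (x /ℕ p) * + p
    rem-spec x = trans (a≡a%ℕn+[a/ℕn]*n x p) (cong (λ r → + r + (x /ℕ p) * + p) (sym (toℕ-fromℕ< (n%ℕd<d x p))))
    divisible : ∀ x → Fin.toℕ (rem x) ≡ 0 → + p ∣ x
    divisible x eq = divides (x /ℕ p) (trans (rem-spec x)
      (trans (cong (λ r → + r + (x /ℕ p) * + p) eq) (ℤ.+-identityˡ _)))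
    i = Fin.toℕ (rem x)
    j = Fin.toℕ (rem y)
    -- The norm of (x , y) minus that of the remainders is `excess * + p`.
    excess = (+ 2 * + i * (x /ℕ p) + (x /ℕ p) * (x /ℕ p) * + p) +
             + 12 * (+ 2 * + j * (y /ℕ p) + (y /ℕ p) * (y /ℕ p) * + p)
    expand : ∀ i j q r P → i * i + + 12 * (j * j) ≡
      ((i + q * P) * (i + q * P) + + 12 * ((j + r * P) * (j + r * P))) -
      ((+ 2 * i * q + q * q * P) + + 12 * (+ 2 * j * r + r * r * P)) * P
    expand = solve-∀
    p∣rem : + p ∣ + (i ℕ.* i ℕ.+ 12 ℕ.* (j ℕ.* j))
    p∣rem = subst (+ p ∣_)
      (trans (sym (trans (expand (+ i) (+ j) (x /ℕ p) (y /ℕ p) (+ p))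
          (cong (_- excess * + p)
            (cong₂ (λ a b → norm (a , b)) (sym (rem-spec x)) (sym (rem-spec y))))))
        (sym (trans (ℤ.pos-+ (i ℕ.* i) _) (cong₂ _+_ (ℤ.pos-* i i)
          (trans (ℤ.pos-* 12 (j ℕ.* j)) (cong (+ 12 *_) (ℤ.pos-* j j)))))))
      (∣m∣n⇒∣m-n p∣norm (∣n⇒∣m*n excess ∣-refl))
    zeros : i ≡ 0 × j ≡ 0
    zeros = check (rem x) (rem y) (∣⇒∣ᵤ p∣rem)


  -- Primes that split in ℚ(√-3).

  module _ {p : ℤ} where

    -- The exact quotient when p ∣ z, and 0 otherwise.
    exactQuotient : ℤ → ℤ
    exactQuotient z with p ∣? z
    ... | yes p∣z = quotient p∣z
    ... | no  _   = 0ℤ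

    exactQuotient-* : ∀ {z} → p ∣ z → p * exactQuotient z ≡ z
    exactQuotient-* {z} p∣z with p ∣? z
    ... | yes (divides q eq) = trans (ℤ.*-comm p q) (sym eq)
    ... | no  p∤z            = contradiction p∣z p∤z

  -- Identify (x , y) with x + 2 y √-3.  For p = α ᾱ with α² = A + 2 B √-3, conjugation followed by
  -- multiplication by α² / p is, where integral, the reflection reflect, which fixes the line x = 2 e y.
  module Split (p : ℕ) .{{_ : NonZero p}} (p-prime : Prime p) (A B e : ℤ)
    (6∣p-1 : + 6 ∣ + p - 1ℤ) (6∣A-1 : + 6 ∣ A - 1ℤ)
    (p∤2 : ¬ + p ∣ + 2) (p∤A : ¬ + p ∣ A) (p∤B : ¬ + p ∣ B)
    (A²+12B² : A * A + + 12 * (B * B) ≡ + p * + p)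
    -- Together these say that `u₁` and `u₂` below send the point (2 e , 1) to p times itself, so
    -- that the reflection fixes its line.
    (axis₁ : B * (+ 2 * e) ≡ + p + A) (axis₂ : + 12 * B + + 2 * e * A ≡ + p * (+ 2 * e)) where

    private
      P = + p
      instance
        P≢0 : ℤ.NonZero P
        P≢0 = ℕ.≢-nonZero (ℕ.≢-nonZero⁻¹ p)
        PP≢0 : ℤ.NonZero (P * P)
        PP≢0 = ℤ.i*j≢0 P P

    -- u₁ + 2 u₂ √-3 is α² times the conjugate of x + 2 y √-3.
    u₁ u₂ : Point → ℤ
    u₁ (x , y) = A * x + + 12 * B * y
    u₂ (x , y) = B * x - A * y

    reflect : Point → Point
    reflect v = exactQuotient {P} (u₁ v) , exactQuotient {P} (u₂ v)

    -- `P ∣ u₂ v` expresses that α divides v without introducing the ring of integers. No sign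
    -- condition on y is imposed, since the reflection need not respect one.
    Aligned : ℤ → Point → Set
    Aligned N v = + 6 ∣ proj₁ v - 1ℤ × norm v ≡ N × P ∣ u₂ v

    -- The two coordinates are proportional modulo p: B u₁ = A u₂ + p² y, and p does not divide B.
    P∣u₁ : ∀ v → P ∣ u₂ v → P ∣ u₁ v
    P∣u₁ (x , y) p∣ = cancel-∤ p-prime B (u₁ (x , y)) p∤B
      (subst (P ∣_) (trans (cong (λ s → A * u₂ (x , y) + s * y) (sym A²+12B²)) (sym (identity A B x y)))
        (∣m∣n⇒∣m+n (∣n⇒∣m*n A p∣) (∣m⇒∣m*n y (∣m⇒∣m*n P ∣-refl))))
      where
      identity : ∀ A B x y → B * (A * x + + 12 * B * y) ≡
                             A * (B * x - A * y) + (A * A + + 12 * (B * B)) * y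
      identity = solve-∀

    module _ {N : ℤ} where

      module _ (v : Point) (aligned : Aligned N v) where

        private
          x = proj₁ v
          y = proj₂ v
          X = proj₁ (reflect v)
          Y = proj₂ (reflect v)

        PX : P * X ≡ u₁ v
        PX = exactQuotient-* (P∣u₁ v (proj₂ (proj₂ aligned)))

        PY : P * Y ≡ u₂ v
        PY = exactQuotient-* (proj₂ (proj₂ aligned))

        -- The matrix of (u₁ , u₂) has trace 0 and squares to A² + 12 B² = p², so dividing it by p
        -- gives an involution.
        u₁-reflect : u₁ (reflect v) ≡ P * x
        u₁-reflect = ℤ.*-cancelˡ-≡ P _ _ (begin
          P * (A * X + + 12 * B * Y)               ≡⟨ distribute P A B X Y ⟩
          A * (P * X) + + 12 * B * (P * Y)         ≡⟨ cong₂ (λ s t → A * s + + 12 * B * t) PX PY ⟩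
          A * u₁ v + + 12 * B * u₂ v               ≡⟨ identity A B x y ⟩
          (A * A + + 12 * (B * B)) * x             ≡⟨ cong (_* x) A²+12B² ⟩
          (P * P) * x                              ≡⟨ ℤ.*-assoc P P x ⟩
          P * (P * x)                              ∎)
          where
          open ≡-Reasoning
          distribute : ∀ P A B X Y → P * (A * X + + 12 * B * Y) ≡ A * (P * X) + + 12 * B * (P * Y)
          distribute = solve-∀
          identity : ∀ A B x y → A * (A * x + + 12 * B * y) + + 12 * B * (B * x - A * y) ≡
                                 (A * A + + 12 * (B * B)) * x
          identity = solve-∀

        u₂-reflect : u₂ (reflect v) ≡ P * y
        u₂-reflect = ℤ.*-cancelˡ-≡ P _ _ (begin
          P * (B * X - A * Y)               ≡⟨ distribute P A B X Y ⟩
          B * (P * X) - A * (P * Y)         ≡⟨ cong₂ (λ s t → B * s - A * t) PX PY ⟩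
          B * u₁ v - A * u₂ v               ≡⟨ identity A B x y ⟩
          (A * A + + 12 * (B * B)) * y      ≡⟨ cong (_* y) A²+12B² ⟩
          (P * P) * y                       ≡⟨ ℤ.*-assoc P P y ⟩
          P * (P * y)                       ∎)
          where
          open ≡-Reasoning
          distribute : ∀ P A B X Y → P * (B * X - A * Y) ≡ B * (P * X) - A * (P * Y)
          distribute = solve-∀
          identity : ∀ A B x y → B * (A * x + + 12 * B * y) - A * (B * x - A * y) ≡
                                 (A * A + + 12 * (B * B)) * y
          identity = solve-∀

        norm-reflect : norm (reflect v) ≡ norm v
        norm-reflect = ℤ.*-cancelˡ-≡ (P * P) _ _ (begin
          (P * P) * norm (X , Y)                                ≡⟨ distribute P X Y ⟩
          norm (P * X , P * Y)                                  ≡⟨ cong₂ (λ s t → norm (s , t)) PX PY ⟩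
          norm (u₁ v , u₂ v)                                    ≡⟨ identity A B x y ⟩
          (A * A + + 12 * (B * B)) * norm v                     ≡⟨ cong (_* norm v) A²+12B² ⟩
          (P * P) * norm v                                      ∎)
          where
          open ≡-Reasoning
          distribute : ∀ P X Y → (P * P) * (X * X + + 12 * (Y * Y)) ≡
                                 (P * X) * (P * X) + + 12 * ((P * Y) * (P * Y))
          distribute = solve-∀
          identity : ∀ A B x y →
            (A * x + + 12 * B * y) * (A * x + + 12 * B * y) + + 12 * ((B * x - A * y) * (B * x - A * y)) ≡
            (A * A + + 12 * (B * B)) * (x * x + + 12 * (y * y))
          identity = solve-∀

        -- Modulo 6, p, A and x are 1 and 12 B vanishes, so X ≡ p X = A x + 12 B y ≡ 1.
        6∣X-1 : + 6 ∣ X - 1ℤ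
        6∣X-1 = subst (+ 6 ∣_) eq
          (∣m∣n⇒∣m-n (∣m∣n⇒∣m+n (∣m∣n⇒∣m+n (∣m⇒∣m*n A (proj₁ aligned)) 6∣A-1)
            (∣m⇒∣m*n (+ 2 * B * y) ∣-refl)) (∣m⇒∣m*n X 6∣p-1))
          where
          collect : ∀ A B P x y X → (((x - 1ℤ) * A + (A - 1ℤ)) + + 6 * (+ 2 * B * y)) - (P - 1ℤ) * X ≡
                    ((A * x + + 12 * B * y) - P * X) + (X - 1ℤ)
          collect = solve-∀
          eq : (((x - 1ℤ) * A + (A - 1ℤ)) + + 6 * (+ 2 * B * y)) - (P - 1ℤ) * X ≡ X - 1ℤ
          eq = trans (collect A B P x y X) (trans (cong (λ s → (u₁ v - s) + (X - 1ℤ)) PX)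
            (trans (cong (_+ (X - 1ℤ)) (ℤ.+-inverseʳ (u₁ v))) (ℤ.+-identityˡ (X - 1ℤ))))

        reflect-aligned : Aligned N (reflect v)
        reflect-aligned = 6∣X-1 , trans norm-reflect (proj₁ (proj₂ aligned)) ,
          subst (P ∣_) (sym u₂-reflect) (∣m⇒∣m*n y ∣-refl)

        -- x - 2 e y is an eigenfunctional of the reflection with eigenvalue -1: its sign tells the
        -- two sides of the fixed line apart, and they are exchanged.
        reflect-axis : X - + 2 * e * Y ≡ - (x - + 2 * e * y)
        reflect-axis = ℤ.*-cancelˡ-≡ P _ _ (begin
          P * (X - + 2 * e * Y)                           ≡⟨ distribute P e X Y ⟩
          P * X - + 2 * e * (P * Y)                       ≡⟨ cong₂ (λ s t → s - + 2 * e * t) PX PY ⟩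
          u₁ v - + 2 * e * u₂ v                           ≡⟨ identity A B e x y ⟩
          A * x - (B * (+ 2 * e)) * x + (+ 12 * B + + 2 * e * A) * y ≡⟨ cong₂ (λ s t → A * x - s * x + t * y) axis₁ axis₂ ⟩
          A * x - (P + A) * x + P * (+ 2 * e) * y         ≡⟨ collect P A e x y ⟩
          P * - (x - + 2 * e * y)                         ∎)
          where
          open ≡-Reasoning
          distribute : ∀ P e X Y → P * (X - + 2 * e * Y) ≡ P * X - + 2 * e * (P * Y)
          distribute = solve-∀
          identity : ∀ A B e x y → (A * x + + 12 * B * y) - + 2 * e * (B * x - A * y) ≡
                     A * x - (B * (+ 2 * e)) * x + (+ 12 * B + + 2 * e * A) * y
          identity = solve-∀
          collect : ∀ P A e x y → A * x - (P + A) * x + P * (+ 2 * e) * y ≡ P * - (x - + 2 * e * y)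
          collect = solve-∀

        -- x ≡ 1 (mod 6) is odd and 2 e y is even.
        off-axis : x - + 2 * e * y ≢ 0ℤ
        off-axis eq with divides k x-1≡ ← proj₁ aligned = 2∤1 (+ 3 * k) (e * y)
          (trans (trans (shift k) (cong (λ z → 1ℤ + z) (sym x-1≡)))
            (trans (restore x (+ 2 * e * y)) (trans (cong (λ z → + 2 * e * y + z) eq) (assoc e y))))
          where
          shift : ∀ k → 1ℤ + + 2 * (+ 3 * k) ≡ 1ℤ + k * + 6
          shift = solve-∀
          restore : ∀ x z → 1ℤ + (x - 1ℤ) ≡ z + (x - z)
          restore = solve-∀
          assoc : ∀ e y → + 2 * e * y + 0ℤ ≡ + 2 * (e * y)
          assoc = solve-∀

      reflect-involutive : ∀ v → Aligned N v → reflect (reflect v) ≡ v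
      reflect-involutive v al = cong₂ _,_
        (ℤ.*-cancelˡ-≡ P _ _ (trans (PX (reflect v) (reflect-aligned v al)) (u₁-reflect v al)))
        (ℤ.*-cancelˡ-≡ P _ _ (trans (PY (reflect v) (reflect-aligned v al)) (u₂-reflect v al)))

      aligned-even : ∀ {ws} → Enumerates ws (Aligned N) → Even (length ws)
      aligned-even ews = even-length ews (λ v → 0ℤ ℤ.<? side v) reflect
        (λ {v} → reflect-aligned v) (λ {v} → reflect-involutive v)
        (λ {v} al 0<s 0<s′ → ℤ.<-asym 0<s (ℤ.neg-cancel-< (subst (0ℤ <_) (reflect-axis v al) 0<s′)))
        (λ {v} al 0≮s → subst (0ℤ <_) (sym (reflect-axis v al))
          (ℤ.neg-mono-< (ℤ.≤∧≢⇒< (ℤ.≮⇒≥ 0≮s) (off-axis v al))))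
        where
        side : Point → ℤ
        side (x , y) = x - + 2 * e * y

    -- A representation divisible by p is aligned with either sign of y. The copy with y > 0 is
    -- already among the representations of p M; the minus sign in `scale` supplies the other one.
    conj scale : Point → Point
    conj  (x , y) = x , - y
    scale (x , y) = P * x , - (P * y)

    norm-conj : ∀ v → norm (conj v) ≡ norm v
    norm-conj (x , y) = identity x y
      where
      identity : ∀ x y → x * x + + 12 * (- y * - y) ≡ x * x + + 12 * (y * y)
      identity = solve-∀

    norm-scale : ∀ v → norm (scale v) ≡ P * (P * norm v)
    norm-scale (x , y) = identity P x y
      where
      identity : ∀ P x y → (P * x) * (P * x) + + 12 * (- (P * y) * - (P * y)) ≡
                           P * (P * (x * x + + 12 * (y * y)))
      identity = solve-∀

    module _ (M n : ℤ) (PM≡ : P * M ≡ + 13 + + 24 * n) where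

      -- With x = 6 k + 1 the norm would be 1 modulo 24, whereas p M is 13.
      y≢0 : ∀ x → + 6 ∣ x - 1ℤ → norm (x , 0ℤ) ≢ P * M
      y≢0 x (divides k x-1≡) norm≡ = 2∤1 n (+ pentagonal k) (ℤ.*-cancelˡ-≡ (+ 12) _ _ (begin
        + 12 * (1ℤ + + 2 * n)                  ≡⟨ collect n ⟩
        (+ 13 + + 24 * n) - 1ℤ                 ≡⟨ cong (_- 1ℤ) (trans (sym PM≡) (sym norm≡)) ⟩
        norm (x , 0ℤ) - 1ℤ                     ≡⟨ factor x ⟩
        (x - 1ℤ) * (x - 1ℤ + + 2)              ≡⟨ cong (λ z → z * (z + + 2)) x-1≡ ⟩
        (k * + 6) * (k * + 6 + + 2)            ≡⟨ identity k ⟩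
        + 12 * (k * (+ 3 * k + 1ℤ))            ≡⟨ cong (+ 12 *_) (sym (pentagonal-double k)) ⟩
        + 12 * (+ 2 * + pentagonal k)          ∎))
        where
        open ≡-Reasoning
        collect : ∀ n → + 12 * (1ℤ + + 2 * n) ≡ (+ 13 + + 24 * n) - 1ℤ
        collect = solve-∀
        factor : ∀ x → (x * x + + 12 * (0ℤ * 0ℤ)) - 1ℤ ≡ (x - 1ℤ) * (x - 1ℤ + + 2)
        factor = solve-∀
        identity : ∀ k → (k * + 6) * (k * + 6 + + 2) ≡ + 12 * (k * (+ 3 * k + 1ℤ))
        identity = solve-∀

      -- The product of the two values of `u₂` is B² x² - A² y² = B² `norm v` - p² y², a multiple of
      -- p.
      aligned-or-conj : ∀ v → norm v ≡ P * M → P ∣ u₂ v ⊎ P ∣ u₂ (conj v)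
      aligned-or-conj (x , y) norm≡ = euclidsLemma-ℤ p-prime (u₂ (x , y)) (u₂ (conj (x , y)))
        (subst (P ∣_) (trans (cong₂ (λ s t → B * B * s - t * (y * y)) (sym norm≡) (sym A²+12B²)) (identity A B x y))
          (∣m∣n⇒∣m-n (∣n⇒∣m*n (B * B) (∣m⇒∣m*n M ∣-refl)) (∣m⇒∣m*n (y * y) (∣m⇒∣m*n P ∣-refl))))
        where
        identity : ∀ A B x y →
          B * B * (x * x + + 12 * (y * y)) - (A * A + + 12 * (B * B)) * (y * y) ≡
          (B * x - A * y) * (B * x - A * - y)
        identity = solve-∀

      both⇒∣y : ∀ x y → P ∣ u₂ (x , y) → P ∣ u₂ (x , - y) → P ∣ y
      both⇒∣y x y p∣ p∣′ = cancel-∤ p-prime A y p∤A (cancel-∤ p-prime (+ 2) (A * y) p∤2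
        (subst (P ∣_) (identity A B x y) (∣m∣n⇒∣m-n p∣′ p∣)))
        where
        identity : ∀ A B x y → (B * x - A * - y) - (B * x - A * y) ≡ + 2 * (A * y)
        identity = solve-∀

      ∣y⇒∣x : ∀ x y → P ∣ u₂ (x , y) → P ∣ y → P ∣ x
      ∣y⇒∣x x y p∣ p∣y = cancel-∤ p-prime B x p∤B
        (subst (P ∣_) (identity A B x y) (∣m∣n⇒∣m+n p∣ (∣n⇒∣m*n A p∣y)))
        where
        identity : ∀ A B x y → (B * x - A * y) + A * y ≡ B * x
        identity = solve-∀

      u₂-scale : ∀ v → P ∣ u₂ (scale v)
      u₂-scale (x , y) = subst (P ∣_) (identity P A B x y) (∣m⇒∣m*n (B * x + A * y) ∣-refl)
        where
        identity : ∀ P A B x y → P * (B * x + A * y) ≡ B * (P * x) - A * - (P * y)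
        identity = solve-∀

      neg-positive : ∀ {y} → 0ℤ < y → ¬ 0ℤ < - y
      neg-positive 0<y 0<-y = ℤ.<-asym 0<y (ℤ.neg-cancel-< 0<-y)

      -- The aligned points fall into three classes: those with y > 0, the conjugates of the points
      -- of `xs` that are not aligned, and the multiples of p with y < 0. The first two together are
      -- as many as `xs`, the third as many as `us`, and the whole is even by the reflection.
      pairing : Pairing p M
      pairing {xs} {us} exs eus = subst Even lengths (aligned-even enumeration)
        where
        good? : Decidable (λ v → P ∣ u₂ v)
        good? v = P ∣? u₂ v
        bad? = ¬? ∘ good?
        conjugates = map conj (filter bad? xs)
        ws = filter good? xs ++ conjugates ++ map scale us

        lengths : length ws ≡ length xs ℕ.+ length us
        lengths = trans (length-++ (filter good? xs)) (trans
          (cong (length (filter good? xs) ℕ.+_) (trans (length-++ conjugates)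
            (cong₂ ℕ._+_ (length-map conj (filter bad? xs)) (length-map scale us))))
          (trans (sym (ℕ.+-assoc (length (filter good? xs)) _ _)) (cong (ℕ._+ length us) (length-filter-¬ good? xs))))

        conj-injective : ∀ {u v} → conj u ≡ conj v → u ≡ v
        conj-injective eq = cong₂ _,_ (cong proj₁ eq) (ℤ.neg-injective (cong proj₂ eq))

        scale-injective : ∀ {u v} → scale u ≡ scale v → u ≡ v
        scale-injective {x , y} {x′ , y′} eq = cong₂ _,_
          (ℤ.*-cancelˡ-≡ P x x′ (cong proj₁ eq))
          (ℤ.*-cancelˡ-≡ P y y′ (ℤ.neg-injective (cong proj₂ eq)))

        good∈ : ∀ {v} → v ∈ filter good? xs → v ∈ xs × P ∣ u₂ v
        good∈ = ∈-filter⁻ good? {xs = xs}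

        conj∈ : ∀ {v} → v ∈ conjugates → ∃[ u ] v ≡ conj u × Represents (P * M) u × ¬ P ∣ u₂ u
        conj∈ v∈ with u , u∈ , refl ← ∈-map⁻ conj v∈ =
          let u∈xs , bad = ∈-filter⁻ bad? {xs = xs} u∈ in u , refl , sound exs u∈xs , bad

        scale∈ : ∀ {v} → v ∈ map scale us → ∃[ u ] v ≡ scale u × Quotient p M u
        scale∈ v∈ with u , u∈ , refl ← ∈-map⁻ scale v∈ = u , refl , sound eus u∈

        unscale : ∀ x y → 0ℤ < y → Aligned (P * M) (scale (x , y)) → Quotient p M (x , y)
        unscale x y 0<y (6∣ , norm≡ , _) =
          (subst (+ 6 ∣_) (residue P x) (∣m∣n⇒∣m-n 6∣ (∣m⇒∣m*n x 6∣p-1)) , 0<y) ,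
          ℤ.*-cancelˡ-≡ P _ _ (trans (sym (norm-scale (x , y))) norm≡)
          where
          residue : ∀ P x → (P * x - 1ℤ) - (P - 1ℤ) * x ≡ x - 1ℤ
          residue = solve-∀

        sound′ : ∀ {v} → v ∈ ws → Aligned (P * M) v
        sound′ v∈ with ∈-++⁻ (filter good? xs) v∈
        ... | inj₁ v∈ˡ = let v∈xs , good = good∈ v∈ˡ ; (6∣ , _) , norm≡ = sound exs v∈xs in 6∣ , norm≡ , good
        ... | inj₂ v∈ʳ with ∈-++⁻ conjugates v∈ʳ
        ...   | inj₁ v∈ᶜ with u , refl , ((6∣ , _) , norm≡) , bad ← conj∈ v∈ᶜ =
          6∣ , trans (norm-conj u) norm≡ , [ (λ good → contradiction good bad) , (λ good → good) ]′ (aligned-or-conj u norm≡)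
        ...   | inj₂ v∈ˢ with (x , y) , refl , (6∣ , _) , norm≡ ← scale∈ v∈ˢ =
          subst (+ 6 ∣_) (residue P x) (∣m∣n⇒∣m+n 6∣ (∣m⇒∣m*n x 6∣p-1)) ,
          trans (norm-scale (x , y)) (cong (P *_) norm≡) , u₂-scale (x , y)
          where
          residue : ∀ P x → (x - 1ℤ) + (P - 1ℤ) * x ≡ P * x - 1ℤ
          residue = solve-∀

        complete′ : ∀ {v} → Aligned (P * M) v → v ∈ ws
        complete′ {x , y} al@(6∣ , norm≡ , good) with ℤ.<-cmp 0ℤ y
        ... | tri< 0<y _ _ = ∈-++⁺ˡ (∈-filter⁺ good? (complete exs ((6∣ , 0<y) , norm≡)) good)
        ... | tri≈ _ refl _ = contradiction norm≡ (y≢0 x 6∣)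
        ... | tri> _ _ y<0 with P ∣? y
        ...   | no p∤y = ∈-++⁺ʳ (filter good? xs) (∈-++⁺ˡ
          (subst (λ z → (x , z) ∈ conjugates) (ℤ.neg-involutive y)
            (∈-map⁺ conj (∈-filter⁺ bad? (complete exs ((6∣ , ℤ.neg-mono-< y<0) ,
              trans (norm-conj (x , y)) norm≡)) (λ good′ → p∤y (both⇒∣y x y good good′))))))
        ...   | yes p∣y with ∣y⇒∣x x y good p∣y | p∣y
        ...     | divides x′ x≡ | divides y′ y≡ = ∈-++⁺ʳ (filter good? xs) (∈-++⁺ʳ conjugates
          (subst (_∈ map scale us) (sym eq) (∈-map⁺ scale (complete eus
            (unscale x′ (- y′) 0<-y′ (subst (Aligned (P * M)) eq al))))))
          where
          reorder : ∀ P z → z * P ≡ - (P * (- z))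
          reorder = solve-∀
          eq : (x , y) ≡ scale (x′ , - y′)
          eq = cong₂ _,_ (trans x≡ (ℤ.*-comm x′ P)) (trans y≡ (reorder P y′))
          0<-y′ : 0ℤ < - y′
          0<-y′ = 0<-cancelˡ p (- y′) (ℤ.neg-cancel-< (subst (_< 0ℤ) (trans y≡ (reorder P y′)) y<0))

        conj-scale-disjoint : Disjoint conjugates (map scale us)
        conj-scale-disjoint (v∈ᶜ , v∈ˢ) with u , refl , _ , bad ← conj∈ v∈ᶜ | (x , y) , eq , _ ← scale∈ v∈ˢ =
          bad (subst (λ w → P ∣ u₂ w) (sym (cong₂ _,_ (cong proj₁ eq)
              (trans (sym (ℤ.neg-involutive (proj₂ u))) (trans (cong -_ (cong proj₂ eq)) (reorder P y)))))
            (u₂-scale (x , - y)))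
          where
          reorder : ∀ P y → - (- (P * y)) ≡ - (P * - y)
          reorder = solve-∀

        good-disjoint : Disjoint (filter good? xs) (conjugates ++ map scale us)
        good-disjoint (v∈ˡ , v∈ʳ) with ∈-++⁻ conjugates v∈ʳ
        ... | inj₁ v∈ᶜ with u , refl , ((_ , 0<y) , _) , _ ← conj∈ v∈ᶜ =
          neg-positive 0<y (Admissible.0<y (proj₁ (sound exs (proj₁ (good∈ v∈ˡ)))))
        ... | inj₂ v∈ˢ with u , refl , (_ , 0<y) , _ ← scale∈ v∈ˢ =
          neg-positive (0<-* p 0<y) (Admissible.0<y (proj₁ (sound exs (proj₁ (good∈ v∈ˡ)))))

        enumeration : Enumerates ws (Aligned (P * M))
        enumeration = record
          { unique   = Unique.++⁺ (Unique.filter⁺ good? (unique exs))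
              (Unique.++⁺ (Unique.map⁺ conj-injective (Unique.filter⁺ bad? (unique exs)))
                (Unique.map⁺ scale-injective (unique eus)) conj-scale-disjoint)
              good-disjoint
          ; sound    = sound′
          ; complete = complete′
          }

-- From representation numbers to the congruences.

open PowerSeriesRing using (q^-⊛-+; q^-⊛-<)
open EtaQuotient using (representations; EOᵤ-count)
open QuadraticForm
open import Data.List.Base using (List; []; _∷_; length; map)
open import Data.List.Membership.Propositional using (_∈_)
open import Data.Product.Base using (_,_; map₂)
open import Data.Integer.Base as ℤ using (ℤ; 0ℤ; 1ℤ; +_)
open import Data.Integer.Divisibility.Signed as ℤ∣ using (divides) renaming (_∣_ to _∣ℤ_)
import Data.Integer.Properties as ℤ
import Data.Integer.Tactic.RingSolver as ℤRing
open import Data.List.Properties using (length-map)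
open import Data.List.Relation.Unary.Any using (here; there)
open import Data.List.Relation.Unary.Unique.Propositional using ([])
open import Data.Nat.Base using (ℕ; suc; _+_; _*_; NonZero; ≢-nonZero; ≢-nonZero⁻¹; _≤_; _<_)
open import Data.Nat.Divisibility as ℕ∣ using (_∣_; _∣?_)
open import Data.Nat.Primality using (Prime; prime?)
import Data.Nat.Properties as ℕ
open import Data.Nat.Tactic.RingSolver using (solve-∀)
open import Function.Base using (_∘_; case_of_)
open import Relation.Binary.PropositionalEquality
open import Relation.Nullary using (¬_; yes; no; contradiction)
open import Relation.Nullary.Decidable using (from-yes; from-no)

-- If a + b = 2 h, then 2 a - 2 b = 4 (h - b).
EOᵤ-parity : ∀ (x y : ℤ) (a b : ℕ) → + 4 ∣ℤ (x ℤ.- + 2 ℤ.* + a) → + 4 ∣ℤ (y ℤ.- + 2 ℤ.* + b) →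
             Even (a + b) → + 4 ∣ℤ (x ℤ.- y)
EOᵤ-parity x y a b 4∣x 4∣y (h , a+b≡h+h) =
  subst (+ 4 ∣ℤ_) eq (ℤ∣.∣m∣n⇒∣m+n (ℤ∣.∣m∣n⇒∣m-n 4∣x 4∣y) (divides (+ h ℤ.- + b) refl))
  where
  regroup : ∀ x y b h → (x ℤ.- + 2 ℤ.* (h ℤ.+ h ℤ.- b)) ℤ.- (y ℤ.- + 2 ℤ.* b) ℤ.+ (h ℤ.- b) ℤ.* + 4 ≡ x ℤ.- y
  regroup = ℤRing.solve-∀
  isolate : ∀ a b → a ≡ (a ℤ.+ b) ℤ.- b
  isolate = ℤRing.solve-∀
  a≡ : + a ≡ + h ℤ.+ + h ℤ.- + b
  a≡ = trans (isolate (+ a) (+ b)) (cong (ℤ._- + b) (cong +_ a+b≡h+h))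
  eq : (x ℤ.- + 2 ℤ.* + a) ℤ.- (y ℤ.- + 2 ℤ.* + b) ℤ.+ (+ h ℤ.- + b) ℤ.* + 4 ≡ x ℤ.- y
  eq = trans (cong (λ z → (x ℤ.- + 2 ℤ.* z) ℤ.- (y ℤ.- + 2 ℤ.* + b) ℤ.+ (+ h ℤ.- + b) ℤ.* + 4) a≡)
    (regroup x y (+ b) (+ h))

dilate-∣ : ∀ p .{{_ : NonZero p}} a k → dilate p a (k * p) ≡ a k
dilate-∣ p a k with p ∣? k * p
... | yes (ℕ∣.divides k′ eq) = cong a (ℕ.*-cancelʳ-≡ k′ k p (sym eq))
... | no p∤kp                = contradiction (ℕ∣.n∣m*n k) p∤kp

dilate-∤ : ∀ p a {j} → ¬ p ∣ j → dilate p a j ≡ 0ℤ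
dilate-∤ p a {j} p∤j with p ∣? j
... | yes p∣j = contradiction p∣j p∤j
... | no _    = refl

⇔-enumerates : ∀ {A : Set} {P Q : A → Set} {xs} → (∀ {x} → P x → Q x) → (∀ {x} → Q x → P x) →
               Enumerates xs P → Enumerates xs Q
⇔-enumerates P⇒Q Q⇒P exs = record
  { unique = Enumerates.unique exs
  ; sound = P⇒Q ∘ Enumerates.sound exs
  ; complete = Enumerates.complete exs ∘ Q⇒P }

points : ℕ → List Point
points n = map point (representations (4 * n + 2))

target : ∀ n → 1ℤ ℤ.+ + 6 ℤ.* + (4 * n + 2) ≡ + (24 * n + 13)
target n = trans (cong (λ z → 1ℤ ℤ.+ + 6 ℤ.* (z ℤ.+ + 2)) (ℤ.pos-* 4 n))
  (trans (expand (+ n)) (cong (ℤ._+ + 13) (sym (ℤ.pos-* 24 n))))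
  where
  expand : ∀ n → 1ℤ ℤ.+ + 6 ℤ.* (+ 4 ℤ.* n ℤ.+ + 2) ≡ + 24 ℤ.* n ℤ.+ + 13
  expand = ℤRing.solve-∀

points-enumerates : ∀ {N} n → + (24 * n + 13) ≡ N → Enumerates (points n) (Represents N)
points-enumerates {N} n eq =
  subst (λ z → Enumerates (points n) (Represents z)) (trans (target n) eq) (representations-enumerates (4 * n + 2))

EOᵤ-points : ∀ n → + 4 ∣ℤ (EOᵤ (4 * n + 2) ℤ.- + 2 ℤ.* + length (points n))
EOᵤ-points n = subst (λ l → + 4 ∣ℤ (EOᵤ (4 * n + 2) ℤ.- + 2 ℤ.* + l))
  (sym (length-map point (representations (4 * n + 2)))) (EOᵤ-count n)

module _ (p r e : ℕ) (24r+13≡ : 24 * r + 13 ≡ p * e) where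

  norm-target : ∀ n → + (24 * (p * n + r) + 13) ≡ + p ℤ.* + (24 * n + e)
  norm-target n = trans (cong +_ (begin
    24 * (p * n + r) + 13       ≡⟨ regroup p n r ⟩
    p * (24 * n) + (24 * r + 13) ≡⟨ cong (λ z → p * (24 * n) + z) 24r+13≡ ⟩
    p * (24 * n) + p * e        ≡⟨ ℕ.*-distribˡ-+ p (24 * n) e ⟨
    p * (24 * n + e)            ∎)) (ℤ.pos-* p (24 * n + e))
    where
    open ≡-Reasoning
    regroup : ∀ p n r → 24 * (p * n + r) + 13 ≡ p * (24 * n) + (24 * r + 13)
    regroup = solve-∀

  aligned-target : ∀ n → + p ℤ.* + (24 * n + e) ≡ + 13 ℤ.+ + 24 ℤ.* + (p * n + r)
  aligned-target n = trans (sym (norm-target n)) (trans (ℤ.+-comm (+ (24 * (p * n + r))) (+ 13))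
    (cong (λ z → + 13 ℤ.+ z) (ℤ.pos-* 24 (p * n + r))))

module _ (p r m e : ℕ) .{{_ : NonZero p}} (p-prime : Prime p) (p∤24 : ¬ p ∣ 24)
  (24r+13≡ : 24 * r + 13 ≡ p * e) (24m+e≡ : 24 * m + e ≡ 13 * p) (m<p : m < p)
  (pairing : ∀ n → Pairing p (+ (24 * n + e))) where

  private
    H : ℕ → ℤ
    H n = EOᵤ (4 * n + 2)

    instance
      P≢0 : ℤ.NonZero (+ p)
      P≢0 = ≢-nonZero (≢-nonZero⁻¹ p)

    -- 24 (n - m) = (24 n + e) - 13 p, and p is prime to 24: a quotient exists only for n in the
    -- residue class of m.
    p∣n-m : ∀ {v} n → Quotient p (+ (24 * n + e)) v → + p ∣ℤ (+ n ℤ.- + m)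
    p∣n-m {v} n (_ , eq) = cancel-∤ p-prime (+ 24) _ (p∤24 ∘ ℤ∣.∣⇒∣ᵤ) (divides (norm v ℤ.- + 13) (begin
      + 24 ℤ.* (+ n ℤ.- + m)
        ≡⟨ regroup (+ n) (+ m) (+ e) ⟩
      (+ 24 ℤ.* + n ℤ.+ + e) ℤ.- (+ 24 ℤ.* + m ℤ.+ + e)
        ≡⟨ cong₂ ℤ._-_ (trans (cong (ℤ._+ + e) (sym (ℤ.pos-* 24 n))) (sym eq))
             (trans (cong (ℤ._+ + e) (sym (ℤ.pos-* 24 m))) (trans (cong +_ 24m+e≡) (ℤ.pos-* 13 p))) ⟩
      + p ℤ.* norm v ℤ.- + 13 ℤ.* + p
        ≡⟨ factor (+ p) (norm v) ⟩
      (norm v ℤ.- + 13) ℤ.* + p ∎))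
      where
      open ≡-Reasoning
      regroup : ∀ n m e → + 24 ℤ.* (n ℤ.- m) ≡ (+ 24 ℤ.* n ℤ.+ e) ℤ.- (+ 24 ℤ.* m ℤ.+ e)
      regroup = ℤRing.solve-∀
      factor : ∀ p z → p ℤ.* z ℤ.- + 13 ℤ.* p ≡ (z ℤ.- + 13) ℤ.* p
      factor = ℤRing.solve-∀

    -- Without quotients the second list of the pairing is empty, so the number of representations
    -- of p M is even by itself.
    congruence-zero : ∀ n → (∀ {v} → ¬ Quotient p (+ (24 * n + e)) v) → + 4 ∣ℤ (H (p * n + r) ℤ.- 0ℤ)
    congruence-zero n none = EOᵤ-parity (H (p * n + r)) 0ℤ (length (points (p * n + r))) 0
      (EOᵤ-points (p * n + r)) (divides 0ℤ refl)
      (pairing n (points-enumerates (p * n + r) (norm-target p r e 24r+13≡ n))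
        record { unique = [] ; sound = λ () ; complete = λ q → contradiction q none })

    congruence-quotient : ∀ k → + 4 ∣ℤ (H (p * (m + k * p) + r) ℤ.- H k)
    congruence-quotient k = EOᵤ-parity (H (p * n + r)) (H k) (length (points (p * n + r))) (length (points k))
      (EOᵤ-points (p * n + r)) (EOᵤ-points k)
      (pairing n (points-enumerates (p * n + r) (norm-target p r e 24r+13≡ n))
        (⇔-enumerates
          (map₂ λ eq → trans (cong (+ p ℤ.*_) eq) (sym M≡))
          (map₂ λ eq → ℤ.*-cancelˡ-≡ (+ p) _ _ (trans eq M≡))
          (points-enumerates k refl)))
      where
      n = m + k * p
      regroup : ∀ m k p e → 24 * (m + k * p) + e ≡ (24 * m + e) + 24 * (k * p)
      regroup = solve-∀
      collect : ∀ k p → 13 * p + 24 * (k * p) ≡ p * (24 * k + 13)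
      collect = solve-∀
      M≡ : + (24 * n + e) ≡ + p ℤ.* + (24 * k + 13)
      M≡ = trans (cong +_ (trans (regroup m k p e) (trans (cong (_+ 24 * (k * p)) 24m+e≡) (collect k p))))
        (ℤ.pos-* p (24 * k + 13))

    difference : ∀ m j → + (m + j) ℤ.- + m ≡ + j
    difference m j = trans (cong (ℤ._- + m) (ℤ.pos-+ m j)) (cancel (+ m) (+ j))
      where
      cancel : ∀ m j → (m ℤ.+ j) ℤ.- m ≡ j
      cancel = ℤRing.solve-∀

    Goal : ℕ → Set
    Goal n = + 4 ∣ℤ (H (p * n + r) ℤ.- (q^ m ⊛ dilate p H) n)

    goal-value : ∀ n z → (q^ m ⊛ dilate p H) n ≡ z → + 4 ∣ℤ (H (p * n + r) ℤ.- z) → Goal n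
    goal-value n z eq = subst (λ z → + 4 ∣ℤ (H (p * n + r) ℤ.- z)) (sym eq)

    goal-∣ : ∀ k → Goal (m + k * p)
    goal-∣ k = goal-value (m + k * p) (H k)
      (trans (q^-⊛-+ m (dilate p H) (k * p)) (dilate-∣ p H k)) (congruence-quotient k)

    goal-∤ : ∀ j → ¬ p ∣ j → Goal (m + j)
    goal-∤ j p∤j = goal-value (m + j) 0ℤ
      (trans (q^-⊛-+ m (dilate p H) j) (dilate-∤ p H p∤j))
      (congruence-zero (m + j)
        (λ q → p∤j (ℤ∣.∣⇒∣ᵤ (subst (+ p ∣ℤ_) (difference m j) (p∣n-m (m + j) q)))))

    goal-≥ : ∀ j → Goal (m + j)
    goal-≥ j = case p ∣? j of λ
      { (yes (ℕ∣.divides k j≡)) → subst (λ i → Goal (m + i)) (sym j≡) (goal-∣ k)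
      ; (no p∤j)                → goal-∤ j p∤j }

    -- Below `m` the shifted series has no terms. Here 0 < m - n ≤ m < p, so n is not in the residue
    -- class of m and there are no quotients either.
    goal-< : ∀ n j → suc n + j ≡ m → Goal n
    goal-< n j eq = goal-value n 0ℤ
      (q^-⊛-< (dilate p H) (ℕ.≤-trans (ℕ.m≤m+n (suc n) j) (ℕ.≤-reflexive eq)))
      (congruence-zero n (λ q → ℕ.<⇒≱ m<p (ℕ.≤-trans (ℕ∣.∣⇒≤ (p∣suc-j q)) suc-j≤m)))
      where
      n+suc-j≡m : n + suc j ≡ m
      n+suc-j≡m = trans (ℕ.+-suc n j) eq
      suc-j≤m : suc j ≤ m
      suc-j≤m = subst (suc j ≤_) n+suc-j≡m (ℕ.m≤n+m (suc j) n)
      negate : ∀ x y → ℤ.- (x ℤ.- y) ≡ y ℤ.- x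
      negate = ℤRing.solve-∀
      p∣suc-j : ∀ {v} → Quotient p (+ (24 * n + e)) v → p ∣ suc j
      p∣suc-j q = ℤ∣.∣⇒∣ᵤ (subst (+ p ∣ℤ_)
        (trans (negate (+ n) (+ m)) (trans (cong (λ z → + z ℤ.- + n) (sym n+suc-j≡m)) (difference n (suc j))))
        (ℤ∣.∣m⇒∣-m (p∣n-m n q)))

    goal : ∀ n → Goal n
    goal n = case m ℕ.≤? n of λ
      { (yes m≤n) → let j , m+j≡n = ℕ.m≤n⇒∃[o]m+o≡n m≤n in subst Goal m+j≡n (goal-≥ j)
      ; (no m≰n)  → let j , eq = ℕ.m≤n⇒∃[o]m+o≡n (ℕ.≰⇒> m≰n) in goal-< n j eq }

  congruence : (λ n → EOᵤ (4 * p * n + 4 * r + 2)) ≡ q^ m ⊛ dilate p (λ n → EOᵤ (4 * n + 2)) [mod + 4 ]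
  congruence n = subst (λ i → + 4 ∣ℤ (EOᵤ i ℤ.- (q^ m ⊛ dilate p H) n)) (index p n r) (goal n)
    where
    index : ∀ p n r → 4 * (p * n + r) + 2 ≡ 4 * p * n + 4 * r + 2
    index = solve-∀

inert-pairing : ∀ p .{{_ : NonZero p}} → + 6 ∣ℤ (+ p ℤ.+ 1ℤ) → InertCheck p → ∀ M → Pairing p M
inert-pairing p 6∣p+1 check = Inert.pairing p 6∣p+1 (inertCheck⇒inert p check)

theorem4p1 : ∀ (p r m : ℕ) →
    (p , r , m) ∈ (5 , 3 , 2) ∷ (7 , 5 , 3) ∷ (11 , 10 , 5) ∷ (17 , 3 , 9) ∷ (19 , 5 , 10) ∷ (23 , 10 , 12) ∷ (29 , 20 , 15) ∷ [] →
    (λ n → EOᵤ (4 * p * n + 4 * r + 2)) ≡ q^ m ⊛ dilate p (λ n → EOᵤ (4 * n + 2)) [mod + 4 ]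
theorem4p1 _ _ _ (here refl) =
  -- In each case the fourth argument `e` is `(24 * r + 13) / p`, and the bound, here `ℕ.m≤m+n 3 2`,
  -- is `m < p` after computation.
  congruence 5 3 2 17 (from-yes (prime? 5)) (from-no (5 ∣? 24)) refl refl (ℕ.m≤m+n 3 2)
    (λ n → inert-pairing 5 (divides (+ 1) refl) (from-yes (inertCheck? 5)) _)
theorem4p1 _ _ _ (there (here refl)) =
  congruence 7 5 3 19 7-prime (from-no (7 ∣? 24)) refl refl (ℕ.m≤m+n 4 3)
    -- 7 = 2² + 3, so α = 2 + √-3 and α² = 1 + 4 √-3: A = 1, B = 2, and the axis is the line of α,
    -- with e = 2.
    (λ n → Split.pairing 7 7-prime (+ 1) (+ 2) (+ 2) (divides (+ 1) refl) (divides (+ 0) refl)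
      (from-no (+ 7 ℤ∣.∣? + 2)) (from-no (+ 7 ℤ∣.∣? + 1)) (from-no (+ 7 ℤ∣.∣? + 2)) refl refl refl
      (+ (24 * n + 19)) (+ (7 * n + 5)) (aligned-target 7 5 19 refl n))
  where
  7-prime = from-yes (prime? 7)
theorem4p1 _ _ _ (there (there (here refl))) =
  congruence 11 10 5 23 (from-yes (prime? 11)) (from-no (11 ∣? 24)) refl refl (ℕ.m≤m+n 6 5)
    (λ n → inert-pairing 11 (divides (+ 2) refl) (from-yes (inertCheck? 11)) _)
theorem4p1 _ _ _ (there (there (there (here refl)))) =
  congruence 17 3 9 5 (from-yes (prime? 17)) (from-no (17 ∣? 24)) refl refl (ℕ.m≤m+n 10 7)
    (λ n → inert-pairing 17 (divides (+ 3) refl) (from-yes (inertCheck? 17)) _)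
theorem4p1 _ _ _ (there (there (there (there (here refl))))) =
  congruence 19 5 10 7 19-prime (from-no (19 ∣? 24)) refl refl (ℕ.m≤m+n 11 8)
    -- 19 = 4² + 3, so α = 4 + √-3 and α² = 13 + 8 √-3: A = 13, B = 4, e = 4.
    (λ n → Split.pairing 19 19-prime (+ 13) (+ 4) (+ 4) (divides (+ 3) refl) (divides (+ 2) refl)
      (from-no (+ 19 ℤ∣.∣? + 2)) (from-no (+ 19 ℤ∣.∣? + 13)) (from-no (+ 19 ℤ∣.∣? + 4)) refl refl refl
      (+ (24 * n + 7)) (+ (19 * n + 5)) (aligned-target 19 5 7 refl n))
  where
  19-prime = from-yes (prime? 19)
theorem4p1 _ _ _ (there (there (there (there (there (here refl)))))) =
  congruence 23 10 12 11 (from-yes (prime? 23)) (from-no (23 ∣? 24)) refl refl (ℕ.m≤m+n 13 10)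
    (λ n → inert-pairing 23 (divides (+ 4) refl) (from-yes (inertCheck? 23)) _)
theorem4p1 _ _ _ (there (there (there (there (there (there (here refl))))))) =
  congruence 29 20 15 17 (from-yes (prime? 29)) (from-no (29 ∣? 24)) refl refl (ℕ.m≤m+n 16 13)
    (λ n → inert-pairing 29 (divides (+ 5) refl) (from-yes (inertCheck? 29)) _)
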